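{- For $k\ge 1$ let $a_k$ denote the number of natural exact covering systems (NECS) consisting of exactly $k$ congruences, and define the formal power series $A(x)=\sum_{k\ge 1}a_k x^k$ and $M(x)=\sum_{k\ge 1}\mu(k)x^k$, where $\mu$ is the number-theoretic M\"obius function. Then $A(x)$ is the unique formal power series solution to the functional equation \[ M(A(x)) = x \] with initial condition $A(0)=0$.
   Context: For integers $n\ge 1$ and $0\le a<n$, let $\langle a,n\rangle=\{x\in\mathbb Z: x\equiv a \pmod n\}$. An exact covering system (ECS) is a finite set $C=\{\langle a_i,n_i\rangle : i=1,\dots,k\}$ of $k\ge1$ pairwise disjoint residue classes whose union is $\mathbb Z$; its size is $|C|=k$. For an ECS $C$, a class $\langle a,n\rangle\in C$ and an integer $r\ge 2$, an $r$-split of $C$ is the ECS obtained by removing $\langle a,n\rangle$ from $C$ and replacing it by the $r$ classes $\langle a+jn, rn\rangle$, $j=0,1,\dots,r-1$. A natural exact covering system (NECS) is an ECS that can be obtained from $\{\langle 0,1\rangle\}=\{\mathbb Z\}$ by a finite (possibly empty) sequence of splits, where the value of $r\ge 2$ may vary from split to split. NECS are counted as sets of residue classes (different split sequences giving the same set of classes count once). -}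

module Defs where

open import Algebra.Bundles using (CommutativeRing)
import Algebra.Properties.Semiring.Mult as SemiringMult
import Algebra.Properties.Semiring.Sum as SemiringSum
open import Data.Bool.Base using (if_then_else_)
open import Data.Fin.Base as Fin using (Fin; combine; toℕ)
open import Data.Integer.Base as ℤ using (ℤ; +_; -[1+_]; 0ℤ; -1ℤ)
open import Data.Integer.Divisibility using (_∣_)
open import Data.List.Base using (List; []; _∷_; length)
open import Data.List.Membership.Propositional using (_∈_)
open import Data.List.Relation.Binary.BagAndSetEquality using (_∼[_]_; [_]-Equality; set)
open import Data.List.Relation.Unary.AllPairs using (AllPairs)
open import Data.List.Relation.Unary.Any using (Any)
open import Data.List.Relation.Unary.Unique.DecPropositional using (unique?)
open import Data.Nat.Base as ℕ using (ℕ; zero; suc; NonZero; _∸_; _≤_)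
import Data.Nat.Properties as ℕ
open import Data.Nat.Primality.Factorisation using (factorise; factors)
open import Data.Product.Base using (_×_; ∃-syntax)
open import Data.Sum.Base using (_⊎_)
open import Function.Base using (_∘_)
open import Function.Bundles using (_⇔_; Bijection)
open import Level using (0ℓ)
open import Relation.Binary.Bundles using (Setoid)
import Relation.Binary.Construct.On as On
open import Relation.Binary.PropositionalEquality using (_≡_; _≢_; setoid)
open import Relation.Nullary.Decidable using (does)
open import Relation.Nullary.Negation using (¬_)

-- An inhabitant of Fin modulus forces modulus ≥ 1 and 0 ≤ residue < modulus.
record ResidueClass : Set where
  constructor mkClass
  field
    modulus : ℕ
    residue : Fin modulus

open ResidueClass public

infix 4 _∈ᶜ_
_∈ᶜ_ : ℤ → ResidueClass → Set
x ∈ᶜ c = + modulus c ∣ x ℤ.- + toℕ (residue c)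

Disjoint : ResidueClass → ResidueClass → Set
Disjoint c d = ∀ x → ¬ (x ∈ᶜ c × x ∈ᶜ d)

-- A class is never disjoint from itself, so the list has no repetitions and
-- its length is the cardinality of the underlying set of classes.
record ECS : Set where
  field
    classes  : List ResidueClass
    disjoint : AllPairs Disjoint classes
    covers   : ∀ x → Any (x ∈ᶜ_) classes

open ECS public

∣_∣ : ECS → ℕ
∣ C ∣ = length (classes C)

ℤ-class : ResidueClass
ℤ-class = mkClass 1 Fin.zero

-- For c = ⟨a , n⟩ this is ⟨a + j n , r n⟩, since
-- toℕ (combine j a) ≡ n * toℕ j + toℕ a.
piece : (r : ℕ) → ResidueClass → Fin r → ResidueClass
piece r c j = mkClass (r ℕ.* modulus c) (combine j (residue c))

-- D has, as a set, the elements of (C ∖ {c}) ∪ {⟨a + j n , r n⟩ : 0 ≤ j < r}.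
IsSplit : (r : ℕ) (c : ResidueClass) (C D : ECS) → Set
IsSplit r c C D = ∀ d →
  d ∈ classes D ⇔ ((d ∈ classes C × d ≢ c) ⊎ (∃[ j ] d ≡ piece r c j))

data Natural : ECS → Set where
  whole : ∀ {C} → classes C ∼[ set ] (ℤ-class ∷ []) → Natural C
  split : ∀ {C D} r c → 2 ≤ r → c ∈ classes C → IsSplit r c C D →
          Natural C → Natural D

record NECS (k : ℕ) : Set where
  field
    system  : ECS
    natural : Natural system
    size    : ∣ system ∣ ≡ k

open NECS public

-- Systems are identified when they are equal as sets of residue classes.
NECS-setoid : ℕ → Setoid 0ℓ 0ℓ
NECS-setoid k =
  On.setoid {B = NECS k} ([ set ]-Equality ResidueClass) (classes ∘ system)

CountsNECS : (ℕ → ℕ) → Set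
CountsNECS a = ∀ k → .{{NonZero k}} → Bijection (setoid (Fin (a k))) (NECS-setoid k)

μ : (n : ℕ) → .{{NonZero n}} → ℤ
μ n = if does (unique? ℕ._≟_ ps) then -1ℤ ℤ.^ length ps else 0ℤ
  where ps = factors (factorise n)

module FormalPowerSeries {c ℓ} (R : CommutativeRing c ℓ) where

  open CommutativeRing R
  open SemiringSum semiring using (sum⁺-syntax)
  open SemiringMult semiring using () renaming (_×_ to _·_)

  -- F n is the coefficient of xⁿ.
  Series : Set c
  Series = ℕ → Carrier

  infix 4 _≋_
  _≋_ : Series → Series → Set ℓ
  F ≋ G = ∀ n → F n ≈ G n

  𝟙 : Series
  𝟙 zero    = 1#
  𝟙 (suc _) = 0#

  X : Series
  X 1 = 1#
  X _ = 0#

  infixl 7 _⊛_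
  _⊛_ : Series → Series → Series
  (F ⊛ G) n = ∑[ i ≤ n ] (F (toℕ i) * G (n ∸ toℕ i))

  infixr 8 _^ˢ_
  _^ˢ_ : Series → ℕ → Series
  F ^ˢ zero  = 𝟙
  F ^ˢ suc k = F ⊛ (F ^ˢ k)

  -- F(G(x)), meaningful only when G 0 ≈ 0#: then Gᵏ has no terms of degree
  -- below k, so truncating the sum over k at n loses nothing.
  infixr 9 _⟪_⟫
  _⟪_⟫ : Series → Series → Series
  (F ⟪ G ⟫) n = ∑[ k ≤ n ] (F (toℕ k) * (G ^ˢ toℕ k) n)

  fromℤ : ℤ → Carrier
  fromℤ (+ n)    = n · 1#
  fromℤ -[1+ n ] = - (suc n · 1#)

  -- Σ_{k≥1} f(k) xᵏ, with integer coefficients read in R.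
  fromPositive : ((k : ℕ) → .{{NonZero k}} → ℤ) → Series
  fromPositive f zero    = 0#
  fromPositive f (suc k) = fromℤ (f (suc k))

  M : Series
  M = fromPositive μ

  IsSolution : Series → Set ℓ
  IsSolution B = B 0 ≈ 0# × M ⟪ B ⟫ ≋ X

{-# OPTIONS --safe #-}
-- If r divides all moduli of a natural system C, then C consists of the classes
-- mod r, each carrying a rescaled natural system; so such systems with k classes
-- are counted by the coefficient of xᵏ in A(x)ʳ. Hence M(A(x)) = Σ_r μ(r) A(x)ʳ
-- counts every natural system C with weight Σ_{r ∣ g} μ(r), where g is the gcd of
-- the moduli of C. This weight is 0 unless g = 1, and as the first split of a
-- system makes all its moduli divisible by some r ≥ 2, only {ℤ} has g = 1.

module Submission where

open import Defs
open import Algebra.Bundles using (CommutativeRing)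
import Algebra.Properties.Ring as RingProperties
import Algebra.Properties.Semiring.Mult as SemiringMult
import Algebra.Properties.Semiring.Sum as SemiringSum
open import Data.Bool.Base using (if_then_else_)
open import Data.Fin.Base as Fin using (Fin; combine; remQuot; toℕ; fromℕ<; cast)
import Data.Fin.Properties as Fin
open import Data.Integer.Base as ℤ using (ℤ; +_; -[1+_]; 0ℤ; -1ℤ)
import Data.Integer.DivMod as ℤ
open import Data.Integer.Divisibility.Signed as Signed using (∣ᵤ⇒∣; ∣⇒∣ᵤ; divides)
  renaming (_∣_ to _∣ₛ_)
import Data.Integer.Properties as ℤ
open import Data.Integer.Tactic.RingSolver using () renaming (solve-∀ to solveℤ-∀)
open import Data.List.Base
  using ( List; []; _∷_; map; concat; tabulate; length; lookup; filter; foldr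
        ; deduplicate; cartesianProductWith)
open import Data.List.Membership.Propositional using (_∈_; _∉_; lose; find)
open import Data.List.Membership.Propositional.Properties
  using ( ∈-map⁺; ∈-map⁻; ∈-concat⁺′; ∈-concat⁻′; ∈-tabulate⁺; ∈-tabulate⁻
        ; ∈-filter⁺; ∈-filter⁻; ∈-lookup)
open import Data.List.Membership.Propositional.Properties.WithK using (unique∧set⇒bag)
import Data.List.Membership.Setoid as Membership
import Data.List.Membership.Setoid.Properties as ∈ₛ
import Data.List.Properties as List
open import Data.List.Relation.Binary.BagAndSetEquality
  using (_∼[_]_; [_]-Equality; set; ∼bag⇒↭)
open import Data.List.Relation.Binary.Permutation.Propositional as ↭
  using (_↭_; ↭-sym; ↭⇒↭ₛ)
import Data.List.Relation.Binary.Permutation.Propositional.Properties as ↭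
import Data.List.Relation.Binary.Permutation.Setoid.Properties as ↭ₛ
import Data.List.Relation.Binary.Subset.DecPropositional as Subset
open import Data.List.Relation.Unary.All as All using (All; []; _∷_)
import Data.List.Relation.Unary.All.Properties as All
open import Data.List.Relation.Unary.AllPairs as AllPairs using (AllPairs; []; _∷_)
import Data.List.Relation.Unary.AllPairs.Properties as AllPairs
open import Data.List.Relation.Unary.Any as Any using (Any; here; there)
import Data.List.Relation.Unary.Any.Properties as Any
open import Data.List.Relation.Unary.Unique.DecPropositional using (unique?)
import Data.List.Relation.Unary.Unique.DecSetoid.Properties as UniqueDec
open import Data.List.Relation.Unary.Unique.Propositional using (Unique)
import Data.List.Relation.Unary.Unique.Propositional.Properties as Unique
import Data.List.Relation.Unary.Unique.Setoid as UniqueSetoid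
import Data.List.Relation.Unary.Unique.Setoid.Properties as UniqueProperties
open import Data.Nat.Base as ℕ
  using (ℕ; zero; suc; NonZero; _≤_; _<_; _∸_; z≤n; s≤s)
open import Data.Nat.Coprimality using (Coprime; coprime-divisor)
open import Data.Nat.Divisibility as ℕ using (_∣_; _∤_; _∣?_)
open import Data.Nat.GCD using (gcd; gcd[m,n]∣m; gcd[m,n]∣n; gcd-greatest)
open import Data.Nat.Induction using (<-rec)
open import Data.Nat.ListAction using (product)
open import Data.Nat.ListAction.Properties using (∈⇒∣product)
open import Data.Nat.Primality using (Prime; prime⇒nonZero; prime⇒irreducible)
open import Data.Nat.Primality.Factorisation
  using ( PrimeFactorisation; factorise; factors; factorisationUnique
        ; factorisationHasAllPrimeFactors)
import Data.Nat.Properties as ℕ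
open import Data.Nat.Tactic.RingSolver using (solve-∀)
open import Data.Product.Base using (_×_; _,_; proj₁; proj₂; ∃-syntax; Σ-syntax)
open import Data.Sum.Base as Sum using (_⊎_; inj₁; inj₂)
open import Data.Vec.Functional as Vector using (updateAt) renaming (_∷_ to _∷ᵥ_)
open import Data.Vec.Functional.Properties using (updateAt-updates; updateAt-minimal)
import Data.Vec.Functional.Relation.Binary.Equality.Setoid as VectorEquality
open import Function.Base using (_∘_; const; it)
open import Function.Bundles using (_⇔_; mk⇔; Equivalence)
open import Level using (Level; 0ℓ)
open import Relation.Binary.Bundles using (Setoid; DecSetoid)
open import Relation.Binary.Definitions as Binary using (DecidableEquality; _Respects_)
open import Relation.Binary.PropositionalEquality as ≡
  using (_≡_; _≢_; _≗_; refl; cong; cong₂; subst; subst₂; module ≡-Reasoning)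
open import Relation.Nullary using (Dec; yes; no; does; map′; _×-dec_)
open import Relation.Nullary.Decidable using (does-⇔; dec-true; dec-false; ¬?)
open import Relation.Nullary.Negation using (¬_; contradiction)
open import Relation.Unary using (Pred; Decidable)

open Equivalence using (to; from)
open PrimeFactorisation using (isFactorisation; factorsPrime)


-- A natural system does not determine its splits: splitting ℤ by 6, by 2 and then 3, or by 3 and
-- then 2 gives the same six classes. So trees of splits are compared by their sets of classes
-- (`_≈ₜ_`) and counted up to that. The same ambiguity is the obstacle to regrouping a system mod
-- `r`: the root of the tree at hand may split by another `s`, and has to be exchanged without
-- changing the classes (`∣ₜ⇒node`). Trees may have nodes of arity 1, because the quotients of `r`
-- and `s` by their gcd can be 1 and because `r = 1` is one of the terms of M(A(x)). `Natural` adds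
-- splits at the leaves, one class at a time, while the count needs the split at the root. Trees
-- mediate: `split-tree` grows them at a leaf, and `natural-combine` turns a root split with natural
-- subsystems back into a sequence of splits. No formula for the number of systems enters: those of
-- each size are enumerated by removing repetitions from a finite list of candidate trees.
-- Uniqueness of the solution is a separate matter: as M(x) = x + ..., the equation M(B(x)) = x
-- determines each coefficient of B from the lower ones.

-- Affine images of residue classes

-- The affine image of d under the increasing bijection from ℤ onto c.
infixr 7 _⊙_
_⊙_ : ResidueClass → ResidueClass → ResidueClass
c ⊙ d = mkClass (modulus d ℕ.* modulus c) (combine (residue d) (residue c))

class-≡ : ∀ {c d} → modulus c ≡ modulus d → toℕ (residue c) ≡ toℕ (residue d) → c ≡ d
class-≡ {mkClass m a} {mkClass .m b} refl eq = cong (mkClass m) (Fin.toℕ-injective eq)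

toℕ-residue-⊙ : ∀ c d → toℕ (residue (c ⊙ d)) ≡
                modulus c ℕ.* toℕ (residue d) ℕ.+ toℕ (residue c)
toℕ-residue-⊙ c d = Fin.toℕ-combine (residue d) (residue c)

-- `piece r c j` is `c ⊙ mkClass r j` by definition, so associativity says that rescaling carries
-- the pieces of a class to the pieces of the rescaled class.
⊙-assoc : ∀ c d e → (c ⊙ d) ⊙ e ≡ c ⊙ (d ⊙ e)
⊙-assoc c d e = class-≡ (≡.sym (ℕ.*-assoc (modulus e) _ _)) (begin
  toℕ (residue ((c ⊙ d) ⊙ e))
    ≡⟨ toℕ-residue-⊙ (c ⊙ d) e ⟩
  modulus d ℕ.* modulus c ℕ.* toℕ (residue e) ℕ.+ toℕ (residue (c ⊙ d))
    ≡⟨ cong (λ z → modulus d ℕ.* modulus c ℕ.* toℕ (residue e) ℕ.+ z) (toℕ-residue-⊙ c d) ⟩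
  modulus d ℕ.* modulus c ℕ.* toℕ (residue e) ℕ.+ (modulus c ℕ.* toℕ (residue d) ℕ.+ toℕ (residue c))
    ≡⟨ regroup (modulus c) (modulus d) _ _ _ ⟩
  modulus c ℕ.* (modulus d ℕ.* toℕ (residue e) ℕ.+ toℕ (residue d)) ℕ.+ toℕ (residue c)
    ≡⟨ cong (λ z → modulus c ℕ.* z ℕ.+ toℕ (residue c)) (toℕ-residue-⊙ d e) ⟨
  modulus c ℕ.* toℕ (residue (d ⊙ e)) ℕ.+ toℕ (residue c)
    ≡⟨ toℕ-residue-⊙ c (d ⊙ e) ⟨
  toℕ (residue (c ⊙ (d ⊙ e))) ∎)
  where
  open ≡-Reasoning
  regroup : ∀ m n x y z → n ℕ.* m ℕ.* x ℕ.+ (m ℕ.* y ℕ.+ z) ≡ m ℕ.* (n ℕ.* x ℕ.+ y) ℕ.+ z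
  regroup = solve-∀

⊙-identityˡ : ∀ c → ℤ-class ⊙ c ≡ c
⊙-identityˡ c = class-≡ (ℕ.*-identityʳ _) (≡.trans (toℕ-residue-⊙ ℤ-class c) (unit _))
  where
  unit : ∀ x → 1 ℕ.* x ℕ.+ 0 ≡ x
  unit = solve-∀

⊙-identityʳ : ∀ c → c ⊙ ℤ-class ≡ c
⊙-identityʳ c = class-≡ (ℕ.*-identityˡ _)
  (≡.trans (toℕ-residue-⊙ c ℤ-class) (cong (ℕ._+ toℕ (residue c)) (ℕ.*-zeroʳ (modulus c))))

modulus-nonZero : ∀ c → NonZero (modulus c)
modulus-nonZero (mkClass (suc _) _) = _

-- Cancelling `r` gives equal moduli; a residue then has only one pair of digits. Blocks over
-- different residues mod `r` therefore share no class, and a union of blocks determines each block.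
⊙-injective : ∀ {r} (i j : Fin r) d e →
              mkClass r i ⊙ d ≡ mkClass r j ⊙ e → i ≡ j × d ≡ e
⊙-injective {r} i j (mkClass m a) (mkClass n b) eq
  with refl ← ℕ.*-cancelʳ-≡ m n r {{modulus-nonZero (mkClass r i)}} (cong modulus eq)
  with refl , refl ← Fin.combine-injective a i b j (Fin.toℕ-injective (cong (λ c → toℕ (residue c)) eq))
  = refl , refl

∈ᶜ⇒∣ : ∀ x c → x ∈ᶜ c → + modulus c ∣ₛ x ℤ.- + toℕ (residue c)
∈ᶜ⇒∣ x c = ∣ᵤ⇒∣ {+ modulus c} {x ℤ.- + toℕ (residue c)}

∣⇒∈ᶜ : ∀ x c → + modulus c ∣ₛ x ℤ.- + toℕ (residue c) → x ∈ᶜ c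
∣⇒∈ᶜ x c = ∣⇒∣ᵤ {+ modulus c} {x ℤ.- + toℕ (residue c)}

∈ᶜ-⊙ˡ : ∀ x c d → x ∈ᶜ c ⊙ d → x ∈ᶜ c
∈ᶜ-⊙ˡ x c d p with divides q eq ← ∈ᶜ⇒∣ x (c ⊙ d) p =
  ∣⇒∈ᶜ x c (divides (q ℤ.* + m ℤ.+ + b) (begin
    x ℤ.- + a                                        ≡⟨ shift x (+ a) (+ (n ℕ.* b)) ⟩
    x ℤ.- (+ (n ℕ.* b) ℤ.+ + a) ℤ.+ + (n ℕ.* b)      ≡⟨ cong (λ k → x ℤ.- + k ℤ.+ + (n ℕ.* b)) (toℕ-residue-⊙ c d) ⟨
    x ℤ.- + toℕ (residue (c ⊙ d)) ℤ.+ + (n ℕ.* b)    ≡⟨ cong₂ ℤ._+_ {x ℤ.- + toℕ (residue (c ⊙ d))}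
                                                           (≡.trans eq (cong (q ℤ.*_) (ℤ.pos-* m n))) (ℤ.pos-* n b) ⟩
    q ℤ.* (+ m ℤ.* + n) ℤ.+ + n ℤ.* + b              ≡⟨ factorₙ q (+ m) (+ n) (+ b) ⟩
    (q ℤ.* + m ℤ.+ + b) ℤ.* + n                      ∎))
  where
  open ≡-Reasoning
  m = modulus d
  n = modulus c
  a = toℕ (residue c)
  b = toℕ (residue d)
  shift : ∀ x a k → x ℤ.- a ≡ x ℤ.- (k ℤ.+ a) ℤ.+ k
  shift = solveℤ-∀
  factorₙ : ∀ q m n b → q ℤ.* (m ℤ.* n) ℤ.+ n ℤ.* b ≡ (q ℤ.* m ℤ.+ b) ℤ.* n
  factorₙ = solveℤ-∀

affine : ResidueClass → ℤ → ℤ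
affine c y = + toℕ (residue c) ℤ.+ y ℤ.* + modulus c

∈ᶜ⇒affine : ∀ x c → x ∈ᶜ c → ∃[ y ] x ≡ affine c y
∈ᶜ⇒affine x c p with divides q eq ← ∈ᶜ⇒∣ x c p =
  q , ≡.trans (cancel x (+ toℕ (residue c))) (cong (ℤ._+_ (+ toℕ (residue c))) eq)
  where
  cancel : ∀ x a → x ≡ a ℤ.+ (x ℤ.- a)
  cancel = solveℤ-∀

affine-⊙ : ∀ c d y → affine c y ℤ.- + toℕ (residue (c ⊙ d)) ≡
           (y ℤ.- + toℕ (residue d)) ℤ.* + modulus c
affine-⊙ c d y = begin
  affine c y ℤ.- + toℕ (residue (c ⊙ d))       ≡⟨ cong (λ z → affine c y ℤ.- + z) (toℕ-residue-⊙ c d) ⟩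
  affine c y ℤ.- (+ (n ℕ.* b) ℤ.+ + a)         ≡⟨ cong (λ z → affine c y ℤ.- (z ℤ.+ + a)) (ℤ.pos-* n b) ⟩
  + a ℤ.+ y ℤ.* + n ℤ.- (+ n ℤ.* + b ℤ.+ + a)  ≡⟨ regroup (+ a) (+ b) (+ n) y ⟩
  (y ℤ.- + b) ℤ.* + n                          ∎
  where
  open ≡-Reasoning
  n = modulus c
  a = toℕ (residue c)
  b = toℕ (residue d)
  regroup : ∀ a b n y → a ℤ.+ y ℤ.* n ℤ.- (n ℤ.* b ℤ.+ a) ≡ (y ℤ.- b) ℤ.* n
  regroup = solveℤ-∀

affine-∈ᶜ⁺ : ∀ y c d → y ∈ᶜ d → affine c y ∈ᶜ c ⊙ d
affine-∈ᶜ⁺ y c d p = ∣⇒∈ᶜ (affine c y) (c ⊙ d) (subst₂ _∣ₛ_ (≡.sym (ℤ.pos-* (modulus d) (modulus c)))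
  (≡.sym (affine-⊙ c d y)) (Signed.*-monoˡ-∣ (+ modulus c) (∈ᶜ⇒∣ y d p)))

affine-∈ᶜ⁻ : ∀ y c d → affine c y ∈ᶜ c ⊙ d → y ∈ᶜ d
affine-∈ᶜ⁻ y c d p = ∣⇒∈ᶜ y d (Signed.*-cancelʳ-∣ (+ modulus c) {{modulus-nonZero c}}
  (subst₂ _∣ₛ_ (ℤ.pos-* (modulus d) (modulus c)) (affine-⊙ c d y) (∈ᶜ⇒∣ (affine c y) (c ⊙ d) p)))

-- A common point lies in `c`, hence is `affine c y` for some `y`, and this `y` would be common to
-- `d` and `e`.
⊙-disjoint : ∀ c {d e} → Disjoint d e → Disjoint (c ⊙ d) (c ⊙ e)
⊙-disjoint c {d} {e} d#e x (x∈d , x∈e) = d#e y (y∈ d x∈d , y∈ e x∈e)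
  where
  preimage = ∈ᶜ⇒affine x c (∈ᶜ-⊙ˡ x c d x∈d)
  y = proj₁ preimage
  y∈ : ∀ d′ → x ∈ᶜ c ⊙ d′ → y ∈ᶜ d′
  y∈ d′ x∈d′ = affine-∈ᶜ⁻ y c d′ (subst (_∈ᶜ c ⊙ d′) (proj₂ preimage) x∈d′)

residue-∈ᶜ : ∀ c → + toℕ (residue c) ∈ᶜ c
residue-∈ᶜ c = ∣⇒∈ᶜ (+ toℕ (residue c)) c (subst (+ modulus c ∣ₛ_) (≡.sym (ℤ.+-inverseʳ (+ toℕ (residue c))))
  (divides (+ 0) refl))

disjoint-irrefl : ∀ {c d} → c ≡ d → ¬ Disjoint c d
disjoint-irrefl {c} refl c#c = c#c (+ toℕ (residue c)) (residue-∈ᶜ c , residue-∈ᶜ c)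

-- A common element makes `r` divide the difference of the two residues, whose absolute value is
-- below `r`.
≢⇒disjoint : ∀ {r} {i j : Fin r} → i ≢ j → Disjoint (mkClass r i) (mkClass r j)
≢⇒disjoint {r} {i} {j} i≢j x (x∈i , x∈j) = i≢j (Fin.toℕ-injective (ℤ.+-injective
  (ℤ.i-j≡0⇒i≡j (+ toℕ i) (+ toℕ j) (ℤ.∣i∣≡0⇒i≡0 (small-multiple r∣i-j ∣i-j∣<r)))))
  where
  cancel : ∀ x a b → (x ℤ.- b) ℤ.- (x ℤ.- a) ≡ a ℤ.- b
  cancel = solveℤ-∀
  r∣i-j : r ℕ.∣ ℤ.∣ + toℕ i ℤ.- + toℕ j ∣
  r∣i-j = ∣⇒∣ᵤ {+ r} {+ toℕ i ℤ.- + toℕ j} (subst (+ r ∣ₛ_) (cancel x (+ toℕ i) (+ toℕ j))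
    (Signed.∣m∣n⇒∣m-n {+ r} {x ℤ.- + toℕ j} (∈ᶜ⇒∣ x (mkClass r j) x∈j) (∈ᶜ⇒∣ x (mkClass r i) x∈i)))
  ∣i-j∣<r : ℤ.∣ + toℕ i ℤ.- + toℕ j ∣ < r
  ∣i-j∣<r = subst (λ z → ℤ.∣ z ∣ < r) (≡.sym (ℤ.m-n≡m⊖n (toℕ i) (toℕ j)))
    (ℕ.≤-<-trans (ℤ.∣m⊝n∣≤m⊔n (toℕ i) (toℕ j)) (ℕ.⊔-pres-<m (Fin.toℕ<n i) (Fin.toℕ<n j)))
  small-multiple : ∀ {m n} → m ℕ.∣ n → n < m → n ≡ 0
  small-multiple {n = zero}  _ _ = refl
  small-multiple {n = suc _} p q = contradiction p (ℕ.>⇒∤ q)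

-- Unions of rescaled systems

sumᵥ : ∀ {n} → (Fin n → ℕ) → ℕ
sumᵥ = Vector.foldr ℕ._+_ 0

-- Opaque so that unification can read r and Cs off ⋃ r Cs.
opaque

  ⋃ : ∀ r → (Fin r → List ResidueClass) → List ResidueClass
  ⋃ r Cs = concat (tabulate λ j → map (mkClass r j ⊙_) (Cs j))

  ∈-⋃⁺ : ∀ {r} {Cs : Fin r → List ResidueClass} j {d} → d ∈ Cs j → mkClass r j ⊙ d ∈ ⋃ r Cs
  ∈-⋃⁺ {r} j d∈ = ∈-concat⁺′ (∈-map⁺ (mkClass r j ⊙_) d∈) (∈-tabulate⁺ j)

  ∈-⋃⁻ : ∀ {r} {Cs : Fin r → List ResidueClass} {c} → c ∈ ⋃ r Cs →
         ∃[ j ] ∃[ d ] d ∈ Cs j × c ≡ mkClass r j ⊙ d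
  ∈-⋃⁻ {r} {Cs} c∈
    with _ , c∈xs , xs∈ ← ∈-concat⁻′ (tabulate λ j → map (mkClass r j ⊙_) (Cs j)) c∈
    with j , refl ← ∈-tabulate⁻ {f = λ j → map (mkClass r j ⊙_) (Cs j)} xs∈
    = j , ∈-map⁻ (mkClass r j ⊙_) c∈xs

  ⋃-disjoint : ∀ {r} {Cs : Fin r → List ResidueClass} →
               (∀ j → AllPairs Disjoint (Cs j)) → AllPairs Disjoint (⋃ r Cs)
  ⋃-disjoint {r} disjoints = AllPairs.concat⁺
    (All.tabulate⁺ λ j → AllPairs.map⁺ (AllPairs.map (⊙-disjoint (mkClass r j)) (disjoints j)))
    (AllPairs.tabulate⁺ λ {i} {j} i≢j →
      All.map⁺ (All.tabulate λ {c} _ → All.map⁺ (All.tabulate λ {d} _ x (x∈c , x∈d) →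
        ≢⇒disjoint i≢j x (∈ᶜ-⊙ˡ x (mkClass r i) c x∈c , ∈ᶜ-⊙ˡ x (mkClass r j) d x∈d))))

  length-⋃ : ∀ r (Cs : Fin r → List ResidueClass) → length (⋃ r Cs) ≡ sumᵥ (length ∘ Cs)
  length-⋃ r Cs = go (mkClass r) Cs
    where
    go : ∀ {n} (f : Fin n → ResidueClass) (Cs : Fin n → List ResidueClass) →
         length (concat (tabulate λ j → map (f j ⊙_) (Cs j))) ≡ sumᵥ (length ∘ Cs)
    go {zero}  f Cs = refl
    go {suc n} f Cs = ≡.trans (List.length-++ (map (f Fin.zero ⊙_) (Cs Fin.zero)))
      (cong₂ ℕ._+_ (List.length-map (f Fin.zero ⊙_) (Cs Fin.zero)) (go (f ∘ Fin.suc) (Cs ∘ Fin.suc)))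

∈-⋃-cancel : ∀ {r} {Cs : Fin r → List ResidueClass} j {d} → mkClass r j ⊙ d ∈ ⋃ r Cs → d ∈ Cs j
∈-⋃-cancel j {d} c∈ with i , e , e∈ , eq ← ∈-⋃⁻ c∈
  with refl , refl ← ⊙-injective j i d e eq = e∈

opaque

  -- Division with remainder, x = j + y r: the remainder `j` selects the block, and the quotient `y`
  -- is covered inside it.
  ⋃-covers : ∀ r .{{_ : NonZero r}} {Cs : Fin r → List ResidueClass} →
             (∀ j x → Any (x ∈ᶜ_) (Cs j)) → ∀ x → Any (x ∈ᶜ_) (⋃ r Cs)
  ⋃-covers r {Cs} covered x =
    let d , d∈ , y∈d = find (covered j y) in
    lose (∈-⋃⁺ {Cs = Cs} j d∈)
      (subst (_∈ᶜ mkClass r j ⊙ d) (≡.sym x≡) (affine-∈ᶜ⁺ y (mkClass r j) d y∈d))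
    where
    j : Fin r
    j = fromℕ< (ℤ.n%ℕd<d x r)
    y : ℤ
    y = x ℤ./ℕ r
    x≡ : x ≡ affine (mkClass r j) y
    x≡ = ≡.trans (ℤ.a≡a%ℕn+[a/ℕn]*n x r)
      (cong (λ k → + k ℤ.+ y ℤ.* + r) (≡.sym (Fin.toℕ-fromℕ< (ℤ.n%ℕd<d x r))))

combineECS : ∀ r .{{_ : NonZero r}} → (Fin r → ECS) → ECS
combineECS r Cs = record
  { classes  = ⋃ r (classes ∘ Cs)
  ; disjoint = ⋃-disjoint (disjoint ∘ Cs)
  ; covers   = ⋃-covers r (covers ∘ Cs)
  }

infix 4 _≃_
_≃_ : List ResidueClass → List ResidueClass → Set
xs ≃ ys = xs ∼[ set ] ys

open Setoid ([ set ]-Equality ResidueClass) public using ()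
  renaming (refl to ≃-refl; sym to ≃-sym; trans to ≃-trans)

⋃-cong : ∀ {r} {Cs Ds : Fin r → List ResidueClass} →
         (∀ j → Cs j ≃ Ds j) → ⋃ r Cs ≃ ⋃ r Ds
⋃-cong eqs = mk⇔ (go eqs) (go (≃-sym ∘ eqs))
  where
  go : ∀ {r} {Cs Ds : Fin r → List ResidueClass} →
       (∀ j → Cs j ≃ Ds j) → ∀ {c} → c ∈ ⋃ r Cs → c ∈ ⋃ r Ds
  go eqs c∈ with j , d , d∈ , refl ← ∈-⋃⁻ c∈ = ∈-⋃⁺ j (to (eqs j) d∈)

⋃-injective : ∀ {r} {Cs Ds : Fin r → List ResidueClass} →
              ⋃ r Cs ≃ ⋃ r Ds → ∀ j → Cs j ≃ Ds j
⋃-injective eq j = mk⇔ (∈-⋃-cancel j ∘ to eq ∘ ∈-⋃⁺ j) (∈-⋃-cancel j ∘ from eq ∘ ∈-⋃⁺ j)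

-- A class x mod s′r can be reached by fixing first its residue mod r, or, if
-- s′r = r′s, first its residue mod s.
⋃-regroup : ∀ {r s r′ s′} → s′ ℕ.* r ≡ r′ ℕ.* s →
            (G : Fin s → Fin r′ → List ResidueClass) (H : Fin r → Fin s′ → List ResidueClass) →
            (∀ i j k l → toℕ (combine j i) ≡ toℕ (combine l k) → G i j ≡ H k l) →
            ⋃ s (λ i → ⋃ r′ (G i)) ≃ ⋃ r (λ k → ⋃ s′ (H k))
⋃-regroup s′r≡r′s G H G≡H =
  mk⇔ (go s′r≡r′s G H G≡H) (go (≡.sym s′r≡r′s) H G (λ k l i j eq → ≡.sym (G≡H i j k l (≡.sym eq))))
  where
  go : ∀ {r s r′ s′} → s′ ℕ.* r ≡ r′ ℕ.* s →
       (G : Fin s → Fin r′ → List ResidueClass) (H : Fin r → Fin s′ → List ResidueClass) →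
       (∀ i j k l → toℕ (combine j i) ≡ toℕ (combine l k) → G i j ≡ H k l) →
       ∀ {c} → c ∈ ⋃ s (λ i → ⋃ r′ (G i)) → c ∈ ⋃ r (λ k → ⋃ s′ (H k))
  go {r} {s} {r′} {s′} eq G H G≡H c∈
    with i , d , d∈ , refl ← ∈-⋃⁻ c∈
    with j , e , e∈ , refl ← ∈-⋃⁻ d∈
    with l , k , lk ← Fin.combine-surjective {s′} {r} (cast (≡.sym eq) (combine j i)) =
    subst (_∈ ⋃ r (λ k → ⋃ s′ (H k))) kle≡ije (∈-⋃⁺ k (∈-⋃⁺ l (subst (e ∈_) (G≡H i j k l ji≡lk) e∈)))
    where
    ji≡lk : toℕ (combine j i) ≡ toℕ (combine l k)
    ji≡lk = ≡.sym (≡.trans (cong toℕ lk) (Fin.toℕ-cast (≡.sym eq) (combine j i)))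
    kle≡ije : mkClass r k ⊙ mkClass s′ l ⊙ e ≡ mkClass s i ⊙ mkClass r′ j ⊙ e
    kle≡ije = ≡.trans (≡.sym (⊙-assoc (mkClass r k) (mkClass s′ l) e))
      (≡.trans (cong (_⊙ e) (class-≡ eq (≡.sym ji≡lk))) (⊙-assoc (mkClass s i) (mkClass r′ j) e))

-- By `⊙-injective` the class removed occurs in block `i` only, and by `⊙-assoc` its pieces are the
-- rescaled pieces of `f`; the other blocks stay as they are.
combine-split : ∀ {s r f} .{{_ : NonZero s}} {Cs Ds : Fin s → ECS} i →
                (∀ j → j ≢ i → Cs j ≡ Ds j) → IsSplit r f (Cs i) (Ds i) →
                IsSplit r (mkClass s i ⊙ f) (combineECS s Cs) (combineECS s Ds)
combine-split {s} {r} {f} {Cs} {Ds} i Cs≡Ds split-f d = mk⇔ there′ back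
  where
  there′ : d ∈ ⋃ s (classes ∘ Ds) →
           (d ∈ ⋃ s (classes ∘ Cs) × d ≢ mkClass s i ⊙ f) ⊎ ∃[ k ] d ≡ piece r (mkClass s i ⊙ f) k
  there′ d∈ with j , e , e∈ , refl ← ∈-⋃⁻ d∈ with j Fin.≟ i
  ... | no j≢i = inj₁
    ( ∈-⋃⁺ j (subst (λ C → e ∈ classes C) (≡.sym (Cs≡Ds j j≢i)) e∈)
    , λ eq → j≢i (proj₁ (⊙-injective j i e f eq)))
  ... | yes refl with to (split-f e) e∈
  ...   | inj₁ (e∈C , e≢f) = inj₁ (∈-⋃⁺ i e∈C , λ eq → e≢f (proj₂ (⊙-injective i i e f eq)))
  ...   | inj₂ (k , refl)  = inj₂ (k , ≡.sym (⊙-assoc (mkClass s i) f (mkClass r k)))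
  back : (d ∈ ⋃ s (classes ∘ Cs) × d ≢ mkClass s i ⊙ f) ⊎ (∃[ k ] d ≡ piece r (mkClass s i ⊙ f) k) →
         d ∈ ⋃ s (classes ∘ Ds)
  back (inj₂ (k , refl)) = subst (_∈ ⋃ s (classes ∘ Ds)) (≡.sym (⊙-assoc (mkClass s i) f (mkClass r k)))
    (∈-⋃⁺ i (from (split-f (piece r f k)) (inj₂ (k , refl))))
  back (inj₁ (d∈ , d≢)) with j , e , e∈ , refl ← ∈-⋃⁻ d∈ with j Fin.≟ i
  ... | no j≢i   = ∈-⋃⁺ j (subst (λ C → e ∈ classes C) (Cs≡Ds j j≢i) e∈)
  ... | yes refl = ∈-⋃⁺ i (from (split-f e) (inj₁ (e∈ , λ e≡f → d≢ (cong (mkClass s i ⊙_) e≡f))))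

-- Natural systems are closed under recombination

natural-resp-≃ : ∀ C D → classes C ≃ classes D → Natural C → Natural D
natural-resp-≃ C D C≃D (whole C≃ℤ) = whole (≃-trans (≃-sym C≃D) C≃ℤ)
-- The result of a split matters only through its members, so only the last split is adapted.
natural-resp-≃ C D C≃D (split r c 2≤r c∈ isSplit natural) =
  split r c 2≤r c∈ (λ d → mk⇔ (to (isSplit d) ∘ from C≃D) (to C≃D ∘ from (isSplit d))) natural

wholeECS : ECS
wholeECS = record
  { classes  = ℤ-class ∷ []
  ; disjoint = [] ∷ []
  ; covers   = λ _ → here (ℕ.1∣ _)
  }

∈-whole : ∀ {c} → c ∈ classes wholeECS → c ≡ ℤ-class
∈-whole (here c≡) = c≡

∈-pieces : ∀ r {d} → d ∈ ⋃ r (const (classes wholeECS)) ⇔ (∃[ j ] d ≡ mkClass r j)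
∈-pieces r {d} = mk⇔ there′ back
  where
  there′ : d ∈ ⋃ r (const (classes wholeECS)) → ∃[ j ] d ≡ mkClass r j
  there′ d∈ with j , e , here refl , refl ← ∈-⋃⁻ {r} d∈ = j , ⊙-identityʳ (mkClass r j)
  back : (∃[ j ] d ≡ mkClass r j) → d ∈ ⋃ r (const (classes wholeECS))
  back (j , refl) = subst (_∈ ⋃ r (const (classes wholeECS))) (⊙-identityʳ (mkClass r j)) (∈-⋃⁺ j (here refl))

whole-split : ∀ r .{{_ : NonZero r}} → IsSplit r ℤ-class wholeECS (combineECS r (const wholeECS))
whole-split r d = mk⇔
  (λ d∈ → let j , d≡ = to (∈-pieces r) d∈ in inj₂ (j , ≡.trans d≡ (≡.sym (⊙-identityˡ (mkClass r j)))))
  λ { (inj₁ (d∈ , d≢))  → contradiction (∈-whole d∈) d≢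
    ; (inj₂ (j , refl)) → from (∈-pieces r) (j , ⊙-identityˡ (mkClass r j)) }

⋃-1 : ∀ {Cs : Fin 1 → List ResidueClass} → ⋃ 1 Cs ≃ Cs Fin.zero
⋃-1 {Cs} {c} = mk⇔ there′ λ c∈ → subst (_∈ ⋃ 1 Cs) (⊙-identityˡ c) (∈-⋃⁺ Fin.zero c∈)
  where
  there′ : ∀ {c} → c ∈ ⋃ 1 Cs → c ∈ Cs Fin.zero
  there′ c∈ with Fin.zero , d , d∈ , refl ← ∈-⋃⁻ c∈ = subst (_∈ Cs Fin.zero) (≡.sym (⊙-identityˡ d)) d∈

infixl 9 _[_]≔_
_[_]≔_ : ∀ {a} {A : Set a} {n} → (Fin n → A) → Fin n → A → Fin n → A
f [ i ]≔ x = updateAt f i (const x)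

-- Any tuple is reached from a constant one by overwriting its entries one by one.
update-induction :
  ∀ {a p q} {A : Set a} (Q : A → Set q) (z : A) {n} (P : (Fin n → A) → Set p) →
  (∀ {f g} → f ≗ g → P f → P g) →
  (∀ f i {x} → Q x → P (f [ i ]≔ z) → P (f [ i ]≔ x)) →
  P (const z) → ∀ f → (∀ i → Q (f i)) → P f
update-induction Q z {zero}  P resp step base f Qf = resp (λ ()) base
update-induction Q z {suc n} P resp step base f Qf =
  resp (λ { Fin.zero → refl ; (Fin.suc _) → refl })
    (step f Fin.zero (Qf Fin.zero)
      (resp (λ { Fin.zero → refl ; (Fin.suc _) → refl })
        (update-induction Q z (λ g → P (z ∷ᵥ g))
          (λ f≗g → resp λ { Fin.zero → refl ; (Fin.suc i) → f≗g i })
          (λ g i Qx p → resp (λ { Fin.zero → refl ; (Fin.suc _) → refl })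
            (step (z ∷ᵥ g) (Fin.suc i) Qx (resp (λ { Fin.zero → refl ; (Fin.suc _) → refl }) p)))
          (resp (λ { Fin.zero → refl ; (Fin.suc _) → refl }) base)
          (f ∘ Fin.suc) (Qf ∘ Fin.suc))))

module _ {s} .{{_ : NonZero s}} where

  combine-resp : ∀ Cs Ds → (∀ j → classes (Cs j) ≃ classes (Ds j)) →
                 Natural (combineECS s Cs) → Natural (combineECS s Ds)
  combine-resp Cs Ds Cs≃Ds = natural-resp-≃ (combineECS s Cs) (combineECS s Ds) (⋃-cong Cs≃Ds)

  ≡⇒≃ : ∀ {C D : ECS} → C ≡ D → classes C ≃ classes D
  ≡⇒≃ refl = ≃-refl

  -- The splits that build `D` are replayed inside block `i`, which starts as one undivided class;
  -- induction on the derivation of `Natural D`.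
  natural-update : ∀ (Cs : Fin s → ECS) i {D} → Natural D →
                   Natural (combineECS s (Cs [ i ]≔ wholeECS)) →
                   Natural (combineECS s (Cs [ i ]≔ D))
  natural-update Cs i {D} (whole D≃ℤ) = combine-resp _ _ λ j → entry j
    where
    entry : ∀ j → classes ((Cs [ i ]≔ wholeECS) j) ≃ classes ((Cs [ i ]≔ D) j)
    entry j with j Fin.≟ i
    ... | no j≢i = ≡⇒≃ (≡.trans (updateAt-minimal j i Cs j≢i) (≡.sym (updateAt-minimal j i Cs j≢i)))
    ... | yes refl = ≃-trans (≡⇒≃ (updateAt-updates j Cs))
      (≃-trans (≃-sym D≃ℤ) (≡⇒≃ (≡.sym (updateAt-updates j Cs))))
  natural-update Cs i {D} (split {C} r c 2≤r c∈ isSplit natural) start =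
    split r (mkClass s i ⊙ c) 2≤r
      (∈-⋃⁺ i (subst (λ E → c ∈ classes E) (≡.sym (updateAt-updates i Cs)) c∈))
      (combine-split {Cs = Cs [ i ]≔ C} {Ds = Cs [ i ]≔ D} i
        (λ j j≢i → ≡.trans (updateAt-minimal j i Cs j≢i) (≡.sym (updateAt-minimal j i Cs j≢i)))
        (subst₂ (IsSplit r c) (≡.sym (updateAt-updates i Cs)) (≡.sym (updateAt-updates i Cs)) isSplit))
      (natural-update Cs i natural start)

natural-pieces : ∀ r .{{_ : NonZero r}} → Natural (combineECS r (const wholeECS))
-- Splits have at least two pieces, so `r = 1` is the empty sequence of splits.
natural-pieces (suc zero)      = whole ⋃-1
natural-pieces r@(suc (suc _)) =
  split {wholeECS} r ℤ-class (s≤s (s≤s z≤n)) (here refl) (whole-split r) (whole ≃-refl)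

-- Split ℤ into the classes mod `r`, then build the given systems in one block after the other; all
-- blocks begin as `wholeECS`.
natural-combine : ∀ r .{{_ : NonZero r}} (Cs : Fin r → ECS) → (∀ j → Natural (Cs j)) →
                  Natural (combineECS r Cs)
natural-combine r = update-induction Natural wholeECS (Natural ∘ combineECS r)
  (λ {Cs} {Ds} Cs≗Ds → combine-resp Cs Ds (≡⇒≃ ∘ Cs≗Ds)) natural-update (natural-pieces r)

-- Systems as trees of splits

-- node r ts splits ℤ into the classes mod r and then, rescaled to the j-th class, ℤ as in ts j.
data Tree : Set where
  leaf : Tree
  node : ∀ r .{{_ : NonZero r}} → (Fin r → Tree) → Tree

⟦_⟧ : Tree → ECS
⟦ leaf ⟧      = wholeECS
⟦ node r ts ⟧ = combineECS r (λ j → ⟦ ts j ⟧)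

infix 4 _≈ₜ_
record _≈ₜ_ (t u : Tree) : Set where
  constructor same
  field sameClasses : classes ⟦ t ⟧ ≃ classes ⟦ u ⟧

open _≈ₜ_ public

treeSetoid : Setoid 0ℓ 0ℓ
treeSetoid = record
  { Carrier       = Tree
  ; _≈_           = _≈ₜ_
  ; isEquivalence = record
    { refl  = same ≃-refl
    ; sym   = λ t≈u → same (≃-sym (sameClasses t≈u))
    ; trans = λ t≈u u≈v → same (≃-trans (sameClasses t≈u) (sameClasses u≈v))
    }
  }

tree-natural : ∀ t → Natural ⟦ t ⟧
tree-natural leaf        = whole ≃-refl
tree-natural (node r ts) = natural-combine r _ (λ j → tree-natural (ts j))

-- Each class of `⟦ t ⟧` comes from a leaf; that leaf becomes a node with `r` leaves, and
-- `combine-split` carries the split up to the root.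
split-tree : ∀ t r .{{_ : NonZero r}} {c} → c ∈ classes ⟦ t ⟧ → ∃[ u ] IsSplit r c ⟦ t ⟧ ⟦ u ⟧
split-tree leaf r (here refl) = node r (const leaf) , whole-split r
split-tree (node s ts) r c∈ with i , f , f∈ , refl ← ∈-⋃⁻ {s} c∈ =
  let u , isSplit = split-tree (ts i) r f∈ in
  node s (ts [ i ]≔ u) , combine-split i
    (λ j j≢i → cong ⟦_⟧ (≡.sym (updateAt-minimal j i ts j≢i)))
    (subst (λ v → IsSplit r f ⟦ ts i ⟧ ⟦ v ⟧) (≡.sym (updateAt-updates i ts)) isSplit)

-- Each split of the derivation is repeated on the tree built so far. `IsSplit` fixes the members of
-- its result, so `C` and the new tree have the same classes.
natural⇒tree : ∀ {C} → Natural C → ∃[ t ] classes C ≃ classes ⟦ t ⟧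
natural⇒tree (whole C≃ℤ) = leaf , C≃ℤ
natural⇒tree (split r c 2≤r c∈ isSplit natural)
  with t , C≃t ← natural⇒tree natural
  with u , isSplit′ ← split-tree t r {{ℕ.>-nonZero (ℕ.≤-trans (s≤s z≤n) 2≤r)}} (to C≃t c∈) =
  u , λ {d} → mk⇔
    (λ d∈ → from (isSplit′ d) (Sum.map₁ (λ (d∈C , d≢c) → to C≃t d∈C , d≢c) (to (isSplit d) d∈)))
    (λ d∈ → from (isSplit d) (Sum.map₁ (λ (d∈t , d≢c) → from C≃t d∈t , d≢c) (to (isSplit′ d) d∈)))

-- Systems whose moduli have a common divisor

infix 4 _∣ₜ_
_∣ₜ_ : ℕ → Tree → Set
r ∣ₜ t = All (λ c → r ∣ modulus c) (classes ⟦ t ⟧)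

∣ₜ-node : ∀ r .{{_ : NonZero r}} ts → r ∣ₜ node r ts
∣ₜ-node r ts = All.tabulate λ c∈ → divisible (∈-⋃⁻ c∈)
  where
  divisible : ∀ {c} → (∃[ j ] ∃[ d ] d ∈ classes ⟦ ts j ⟧ × c ≡ mkClass r j ⊙ d) → r ∣ modulus c
  divisible (_ , d , _ , refl) = ℕ.n∣m*n (modulus d)

-- Used with `m` the arity wanted at the root and `n` the arity found there: if `m` divides `k * n`,
-- then `m′` divides `k * n′`, and coprimality gives `m′ ∣ k`. In this way divisibility of all
-- moduli passes to the subtrees.
coprime-quotients : ∀ m n .{{_ : NonZero m}} →
                    ∃[ g ] ∃[ m′ ] ∃[ n′ ] m ≡ m′ ℕ.* g × n ≡ n′ ℕ.* g × Coprime m′ n′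
coprime-quotients m n with gcd[m,n]∣m m n | gcd[m,n]∣n m n
... | ℕ.divides m′ m≡ | ℕ.divides n′ n≡ = gcd m n , m′ , n′ , m≡ , n≡ , coprime
  where
  instance
    gcd≢0 : NonZero (gcd m n)
    gcd≢0 = ℕ.m*n≢0⇒n≢0 m′ {{subst NonZero m≡ it}}
  coprime : Coprime m′ n′
  coprime {i} (i∣m′ , i∣n′) = ℕ.∣1⇒≡1 (ℕ.*-cancelʳ-∣ (gcd m n)
    (subst (i ℕ.* gcd m n ∣_) (≡.sym (ℕ.*-identityˡ _))
      (gcd-greatest (subst (i ℕ.* gcd m n ∣_) (≡.sym m≡) (ℕ.*-monoˡ-∣ (gcd m n) i∣m′))
                    (subst (i ℕ.* gcd m n ∣_) (≡.sym n≡) (ℕ.*-monoˡ-∣ (gcd m n) i∣n′)))))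

-- With g = gcd r s, r = r′g and s = s′g, the system splits mod s and then, by
-- induction, mod r′; as r′s = s′r, it also splits mod r and then mod s′.
∣ₜ⇒node : ∀ t r .{{_ : NonZero r}} → r ∣ₜ t → ∃[ ts ] t ≈ₜ node r ts
∣ₜ⇒node leaf r r∣t with refl ← ℕ.∣1⇒≡1 (All.lookup r∣t (here refl)) = const leaf , same (≃-sym ⋃-1)
∣ₜ⇒node (node s ts) r r∣t with g , r′ , s′ , refl , refl , coprime ← coprime-quotients r s =
  (λ k → node s′ (λ l → G′ k l)) ,
  same (≃-trans (⋃-cong (λ i → sameClasses (proj₂ (IH i))))
    (⋃-regroup eq (λ i j → classes ⟦ G i j ⟧) (λ k l → classes ⟦ G′ k l ⟧) G≡G′))
  where
  instance
    r′≢0 : NonZero r′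
    r′≢0 = ℕ.m*n≢0⇒m≢0 r′
    s′≢0 : NonZero s′
    s′≢0 = ℕ.m*n≢0⇒m≢0 s′
    g≢0 : NonZero g
    g≢0 = ℕ.m*n≢0⇒n≢0 s′
  regroup : ∀ m s g → m ℕ.* (s ℕ.* g) ≡ (s ℕ.* m) ℕ.* g
  regroup = solve-∀
  r′∣ : ∀ i → r′ ∣ₜ ts i
  r′∣ i = All.tabulate λ {c} c∈ → coprime-divisor coprime (ℕ.*-cancelʳ-∣ g
    (subst (r′ ℕ.* g ∣_) (regroup (modulus c) s′ g) (All.lookup r∣t (∈-⋃⁺ i c∈))))
  IH : ∀ i → ∃[ us ] ts i ≈ₜ node r′ us
  IH i = ∣ₜ⇒node (ts i) r′ (r′∣ i)
  G : Fin (s′ ℕ.* g) → Fin r′ → Tree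
  G i = proj₁ (IH i)
  eq : s′ ℕ.* (r′ ℕ.* g) ≡ r′ ℕ.* (s′ ℕ.* g)
  eq = ≡.trans (regroup s′ r′ g) (ℕ.*-assoc r′ s′ g)
  G′ : Fin (r′ ℕ.* g) → Fin s′ → Tree
  G′ k l = let j , i = remQuot (s′ ℕ.* g) (cast eq (combine l k)) in G i j
  G≡G′ : ∀ i j k l → toℕ (combine j i) ≡ toℕ (combine l k) → classes ⟦ G i j ⟧ ≡ classes ⟦ G′ k l ⟧
  G≡G′ i j k l ji≡lk = cong (λ (j , i) → classes ⟦ G i j ⟧) (begin
    j , i                                          ≡⟨ Fin.remQuot-combine j i ⟨
    remQuot (s′ ℕ.* g) (combine j i)               ≡⟨ cong (remQuot _) (Fin.toℕ-injective
                                                        (≡.trans ji≡lk (≡.sym (Fin.toℕ-cast eq (combine l k))))) ⟩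
    remQuot (s′ ℕ.* g) (cast eq (combine l k))     ∎)
    where open ≡-Reasoning

-- A node of arity 1 has the classes of its only subtree, so such nodes at the root can be stripped
-- until a leaf or a proper split appears.
leaf-or-node : ∀ t → t ≈ₜ leaf ⊎ ∃[ r ] ∃[ ts ] t ≈ₜ node (suc (suc r)) ts
leaf-or-node leaf                    = inj₁ (same ≃-refl)
leaf-or-node (node (suc (suc r)) ts) = inj₂ (r , ts , same ≃-refl)
leaf-or-node (node (suc zero) ts) with leaf-or-node (ts Fin.zero)
... | inj₁ eq            = inj₁ (same (≃-trans ⋃-1 (sameClasses eq)))
... | inj₂ (r , us , eq) = inj₂ (r , us , same (≃-trans ⋃-1 (sameClasses eq)))

leaves : Tree → ℕ
leaves t = ∣ ⟦ t ⟧ ∣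

leaves-node : ∀ r .{{_ : NonZero r}} ts → leaves (node r ts) ≡ sumᵥ (leaves ∘ ts)
leaves-node r ts = length-⋃ r (λ j → classes ⟦ ts j ⟧)

classes-unique : ∀ C → Unique (classes C)
classes-unique C = AllPairs.map (λ c#d c≡d → disjoint-irrefl c≡d c#d) (disjoint C)

≃⇒∣∣≡ : ∀ C D → classes C ≃ classes D → ∣ C ∣ ≡ ∣ D ∣
≃⇒∣∣≡ C D C≃D = ↭.↭-length (∼bag⇒↭ (unique∧set⇒bag (classes-unique C) (classes-unique D) C≃D))

leaves-cong : ∀ {t u} → t ≈ₜ u → leaves t ≡ leaves u
leaves-cong {t} {u} t≈u = ≃⇒∣∣≡ ⟦ t ⟧ ⟦ u ⟧ (sameClasses t≈u)

leaves-positive : ∀ t → 0 < leaves t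
leaves-positive t with classes ⟦ t ⟧ | covers ⟦ t ⟧ (+ 0)
... | _ ∷ _ | _ = s≤s z≤n

-- Enumeration of the natural systems

module _ {a ℓ} (S : Setoid a ℓ) where
  open Setoid S using (_≈_) renaming (sym to ≈-sym; trans to ≈-trans; reflexive to ≈-reflexive)
  open Membership S renaming (_∈_ to _∈ˢ_)
  open UniqueSetoid S using () renaming (Unique to Uniqueˢ)

  unique⇒lookup-injective : ∀ {xs} → Uniqueˢ xs → ∀ i j → lookup xs i ≈ lookup xs j → i ≡ j
  unique⇒lookup-injective (x∉ ∷ _) Fin.zero Fin.zero _ = refl
  unique⇒lookup-injective (x∉ ∷ _) Fin.zero (Fin.suc j) eq =
    contradiction eq (All.lookup x∉ (∈-lookup j))
  unique⇒lookup-injective (x∉ ∷ _) (Fin.suc i) Fin.zero eq =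
    contradiction (≈-sym eq) (All.lookup x∉ (∈-lookup i))
  unique⇒lookup-injective (_ ∷ xs!) (Fin.suc i) (Fin.suc j) eq =
    cong Fin.suc (unique⇒lookup-injective xs! i j eq)

  -- Pigeonhole: sending each entry of `xs` to the position of its match in `ys` is injective.
  unique-⊆⇒length≤ : ∀ {xs ys} → Uniqueˢ xs → (∀ {x} → x ∈ˢ xs → x ∈ˢ ys) → length xs ≤ length ys
  unique-⊆⇒length≤ {xs} {ys} xs! xs⊆ys = Fin.injective⇒≤ {f = position} λ {i} {j} eq →
    unique⇒lookup-injective xs! i j (≈-trans (at i) (≈-trans (≈-reflexive (cong (lookup ys) eq)) (≈-sym (at j))))
    where
    found : ∀ i → lookup xs i ∈ˢ ys
    found i = xs⊆ys (∈ₛ.∈-lookup S xs i)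
    position : Fin (length xs) → Fin (length ys)
    position i = Any.index (found i)
    at : ∀ i → lookup xs i ≈ lookup ys (position i)
    at i = Any.lookup-index (found i)

  unique-≃⇒length≡ : ∀ {xs ys} → Uniqueˢ xs → Uniqueˢ ys →
                     (∀ {x} → x ∈ˢ xs → x ∈ˢ ys) → (∀ {x} → x ∈ˢ ys → x ∈ˢ xs) → length xs ≡ length ys
  unique-≃⇒length≡ xs! ys! xs⊆ys ys⊆xs =
    ℕ.≤-antisym (unique-⊆⇒length≤ xs! xs⊆ys) (unique-⊆⇒length≤ ys! ys⊆xs)

infix 4 _≟ᶜ_ _≃?_ _≟ₜ_ _∣ₜ?_
_≟ᶜ_ : DecidableEquality ResidueClass
c ≟ᶜ d = map′ (λ (m≡ , a≡) → class-≡ m≡ a≡) (λ { refl → refl , refl })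
  ((modulus c ℕ.≟ modulus d) ×-dec (toℕ (residue c) ℕ.≟ toℕ (residue d)))

open Subset _≟ᶜ_ using (_⊆_; _⊆?_)

_≃?_ : Binary.Decidable _≃_
xs ≃? ys = map′ antisym inclusions ((xs ⊆? ys) ×-dec (ys ⊆? xs))
  where
  antisym : xs ⊆ ys × ys ⊆ xs → xs ≃ ys
  antisym (xs⊆ys , ys⊆xs) = mk⇔ xs⊆ys ys⊆xs
  inclusions : xs ≃ ys → xs ⊆ ys × ys ⊆ xs
  inclusions xs≃ys = to xs≃ys , from xs≃ys

_≟ₜ_ : Binary.Decidable _≈ₜ_
t ≟ₜ u = map′ same sameClasses (classes ⟦ t ⟧ ≃? classes ⟦ u ⟧)

treeDecSetoid : DecSetoid 0ℓ 0ℓ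
treeDecSetoid = record
  { isDecEquivalence = record { isEquivalence = Setoid.isEquivalence treeSetoid ; _≟_ = _≟ₜ_ } }

_∣ₜ?_ : ∀ r t → Dec (r ∣ₜ t)
r ∣ₜ? t = All.all? (λ c → r ∣? modulus c) (classes ⟦ t ⟧)

∣ₜ-resp : ∀ {r} → (r ∣ₜ_) Respects _≈ₜ_
∣ₜ-resp t≈u r∣t = All.tabulate (All.lookup r∣t ∘ from (sameClasses t≈u))

open Membership treeSetoid using () renaming (_∈_ to _∈ₜ_)
open UniqueSetoid treeSetoid using () renaming (Unique to Uniqueₜ)
open VectorEquality treeSetoid using (≋-setoid) renaming (_≋_ to _≋ₜ_)
open Setoid treeSetoid using () renaming (refl to ≈ₜ-refl; sym to ≈ₜ-sym; trans to ≈ₜ-trans)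

node-cong : ∀ {r} .{{_ : NonZero r}} {ts us : Fin r → Tree} → ts ≋ₜ us → node r ts ≈ₜ node r us
node-cong ts≋us = same (⋃-cong (λ j → sameClasses (ts≋us j)))

node-injective : ∀ {r} .{{_ : NonZero r}} {ts us : Fin r → Tree} → node r ts ≈ₜ node r us → ts ≋ₜ us
node-injective eq j = same (⋃-injective (sameClasses eq) j)

-- The recursion copies `_^ˢ_` and the Cauchy product: a head of size `i`, a rest of size `k ∸ i`.
-- The length of `tuples L r k` is thus the coefficient of xᵏ in the `r`-th power of the series with
-- coefficients `length (L i)`.
tuples : (ℕ → List Tree) → ∀ r → ℕ → List (Fin r → Tree)
tuplesByHead : (ℕ → List Tree) → ∀ r k → Fin (suc k) → List (Fin (suc r) → Tree)

tuples L zero    zero    = (λ ()) ∷ []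
tuples L zero    (suc _) = []
tuples L (suc r) k       = concat (tabulate (tuplesByHead L r k))

tuplesByHead L r k i = cartesianProductWith _∷ᵥ_ (L (toℕ i)) (tuples L r (k ∸ toℕ i))

sum-leaves : ∀ {r} → (Fin r → Tree) → ℕ
sum-leaves ts = sumᵥ (leaves ∘ ts)

∷-cong : ∀ {r t u} {ts us : Fin r → Tree} → t ≈ₜ u → ts ≋ₜ us → (t ∷ᵥ ts) ≋ₜ (u ∷ᵥ us)
∷-cong t≈u ts≋us Fin.zero    = t≈u
∷-cong t≈u ts≋us (Fin.suc j) = ts≋us j

module _ (L : ℕ → List Tree) where

  ∈-tuples⁺ : ∀ {r} (ts : Fin r → Tree) → (∀ j → ts j ∈ₜ L (leaves (ts j))) →
              Membership._∈_ (≋-setoid r) ts (tuples L r (sum-leaves ts))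
  ∈-tuples⁺ {zero}  ts ts∈ = here λ ()
  ∈-tuples⁺ {suc r} ts ts∈ = ∈ₛ.∈-concat⁺ (≋-setoid (suc r))
    (Any.tabulate⁺ {f = tuplesByHead L r (sum-leaves ts)} i
    (∈ₛ.∈-resp-≈ (≋-setoid (suc r)) (λ { Fin.zero → ≈ₜ-refl ; (Fin.suc _) → ≈ₜ-refl })
      (∈ₛ.∈-cartesianProductWith⁺ treeSetoid (≋-setoid r) (≋-setoid (suc r)) ∷-cong
        (subst (λ m → ts Fin.zero ∈ₜ L m) (≡.sym i≡) (ts∈ Fin.zero))
        (subst (λ m → Membership._∈_ (≋-setoid r) (ts ∘ Fin.suc) (tuples L r m)) (≡.sym rest)
          (∈-tuples⁺ (ts ∘ Fin.suc) (ts∈ ∘ Fin.suc))))))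
    where
    i<1+k : leaves (ts Fin.zero) < suc (sum-leaves ts)
    i<1+k = s≤s (ℕ.m≤m+n _ _)
    i : Fin (suc (sum-leaves ts))
    i = fromℕ< i<1+k
    i≡ : toℕ i ≡ leaves (ts Fin.zero)
    i≡ = Fin.toℕ-fromℕ< i<1+k
    rest : sum-leaves ts ∸ toℕ i ≡ sum-leaves (ts ∘ Fin.suc)
    rest = ≡.trans (cong (sum-leaves ts ∸_) i≡) (ℕ.m+n∸m≡n (leaves (ts Fin.zero)) _)

  module _ (sized : ∀ {k t} → t ∈ₜ L k → leaves t ≡ k) where

    ∈-tuples⁻ : ∀ {r k} (ts : Fin r → Tree) → Membership._∈_ (≋-setoid r) ts (tuples L r k) →
                sum-leaves ts ≡ k
    ∈-tuples⁻ {zero}  {zero} ts _ = refl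
    ∈-tuples⁻ {suc r} {k} ts ts∈
      with i , ts∈ᵢ ← Any.tabulate⁻ {f = tuplesByHead L r k}
             (∈ₛ.∈-concat⁻ (≋-setoid (suc r)) (tabulate (tuplesByHead L r k)) ts∈)
      with t , us , t∈ , us∈ , ts≋ ← ∈ₛ.∈-cartesianProductWith⁻ treeSetoid (≋-setoid r) (≋-setoid (suc r))
             _∷ᵥ_ (L (toℕ i)) (tuples L r (k ∸ toℕ i)) ts∈ᵢ = begin
      leaves (ts Fin.zero) ℕ.+ sum-leaves (ts ∘ Fin.suc)
        ≡⟨ cong₂ ℕ._+_ (≡.trans (leaves-cong (ts≋ Fin.zero)) (sized t∈))
             (∈-tuples⁻ (ts ∘ Fin.suc) (∈ₛ.∈-resp-≈ (≋-setoid r) (λ j → ≈ₜ-sym (ts≋ (Fin.suc j))) us∈)) ⟩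
      toℕ i ℕ.+ (k ∸ toℕ i)
        ≡⟨ ℕ.m+[n∸m]≡n (ℕ.s≤s⁻¹ (Fin.toℕ<n i)) ⟩
      k ∎
      where open ≡-Reasoning

    tuples-unique : (∀ k → Uniqueₜ (L k)) → ∀ r k → UniqueSetoid.Unique (≋-setoid r) (tuples L r k)
    tuples-unique L! zero    zero    = [] ∷ []
    tuples-unique L! zero    (suc k) = []
    tuples-unique L! (suc r) k       = UniqueProperties.concat⁺ (≋-setoid (suc r))
      (All.tabulate⁺ λ i → UniqueProperties.cartesianProductWith⁺
        treeSetoid (≋-setoid r) (≋-setoid (suc r)) _∷ᵥ_
        (λ eq → eq Fin.zero , λ j → eq (Fin.suc j)) (L! (toℕ i)) (tuples-unique L! r (k ∸ toℕ i)))
      -- Lists for different head sizes are disjoint, since the head determines its number of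
      -- leaves.
      (AllPairs.tabulate⁺ λ {i} {j} i≢j {v} (v∈i , v∈j) →
        i≢j (Fin.toℕ-injective (≡.trans (≡.sym (headSize i v v∈i)) (headSize j v v∈j))))
      where
      headSize : ∀ (i : Fin (suc k)) v →
        Membership._∈_ (≋-setoid (suc r)) v (tuplesByHead L r k i) →
        leaves (v Fin.zero) ≡ toℕ i
      headSize i v v∈ with t , us , t∈ , us∈ , v≋ ← ∈ₛ.∈-cartesianProductWith⁻ treeSetoid (≋-setoid r)
                             (≋-setoid (suc r)) _∷ᵥ_ (L (toℕ i)) (tuples L r (k ∸ toℕ i)) v∈ =
        ≡.trans (leaves-cong (v≋ Fin.zero)) (sized t∈)

n≤sumᵥ : ∀ {n} (f : Fin n → ℕ) → (∀ j → 0 < f j) → n ≤ sumᵥ f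
n≤sumᵥ {zero}  f 0<f = z≤n
n≤sumᵥ {suc n} f 0<f = ℕ.+-mono-≤ (0<f Fin.zero) (n≤sumᵥ (f ∘ Fin.suc) (0<f ∘ Fin.suc))

-- Each of the n - 1 other entries is at least 1; the 1 stands on the right to avoid subtraction.
f+n≤1+sumᵥ : ∀ {n} (f : Fin n → ℕ) → (∀ j → 0 < f j) → ∀ j → f j ℕ.+ n ≤ suc (sumᵥ f)
f+n≤1+sumᵥ {suc n} f 0<f Fin.zero = subst (_≤ suc (sumᵥ f)) (≡.sym (ℕ.+-suc (f Fin.zero) n))
  (s≤s (ℕ.+-monoʳ-≤ (f Fin.zero) (n≤sumᵥ (f ∘ Fin.suc) (0<f ∘ Fin.suc))))
f+n≤1+sumᵥ {suc n} f 0<f (Fin.suc j) = subst (_≤ suc (sumᵥ f)) (≡.sym (ℕ.+-suc (f (Fin.suc j)) n))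
  (s≤s (ℕ.≤-trans (f+n≤1+sumᵥ (f ∘ Fin.suc) (0<f ∘ Fin.suc) j)
    (ℕ.+-monoˡ-≤ (sumᵥ (f ∘ Fin.suc)) (0<f Fin.zero))))

child-leaves< : ∀ r (ts : Fin (suc (suc r)) → Tree) j → leaves (ts j) < leaves (node (suc (suc r)) ts)
child-leaves< r ts j = subst (leaves (ts j) <_) (≡.sym (leaves-node (suc (suc r)) ts))
  (ℕ.s≤s⁻¹ (ℕ.≤-trans (ℕ.≤-reflexive (≡.sym (ℕ.+-comm (leaves (ts j)) 2)))
    (ℕ.≤-trans (ℕ.+-monoʳ-≤ (leaves (ts j)) (s≤s (s≤s z≤n)))
      (f+n≤1+sumᵥ (leaves ∘ ts) (leaves-positive ∘ ts) j))))

arity≤leaves : ∀ r .{{_ : NonZero r}} ts → r ≤ leaves (node r ts)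
arity≤leaves r ts = subst (r ≤_) (≡.sym (leaves-node r ts)) (n≤sumᵥ (leaves ∘ ts) (leaves-positive ∘ ts))

-- By `∣ₜ⇒node` such a tree can be rewritten with `r` children, each having a leaf. So the common
-- divisors of the moduli lie within the range of the truncated sum for M(A(x)).
∣ₜ⇒≤leaves : ∀ r .{{_ : NonZero r}} t → r ∣ₜ t → r ≤ leaves t
∣ₜ⇒≤leaves r t r∣t with ts , t≈ ← ∣ₜ⇒node t r r∣t =
  subst (r ≤_) (≡.sym (leaves-cong t≈)) (arity≤leaves r ts)

-- Membership and uniqueness are up to `_≈ₜ_`, so that `list` has one tree for each natural system
-- with `k` classes, however many trees describe it.
record Enumeration (k : ℕ) : Set where
  field
    list     : List Tree
    unique   : Uniqueₜ list
    sized    : ∀ {t} → t ∈ₜ list → leaves t ≡ k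
    complete : ∀ t → leaves t ≡ k → t ∈ₜ list

open Enumeration

module _ k (smaller : ∀ {i} → i < k → Enumeration i) where

  smallerTrees : ℕ → List Tree
  smallerTrees i with i ℕ.<? k
  ... | yes i<k = list (smaller i<k)
  -- Sizes from `k` on get no trees. Nothing is lost: the children of a root of arity at least 2
  -- have fewer leaves than the whole tree.
  ... | no _    = []

  ∈-smallerTrees : ∀ {t} → leaves t < k → t ∈ₜ smallerTrees (leaves t)
  ∈-smallerTrees {t} t<k with leaves t ℕ.<? k
  ... | yes t<k′ = complete (smaller t<k′) t refl
  ... | no t≮k   = contradiction t<k t≮k

  -- By `arity≤leaves` the arities 1 to `k` suffice. Repetitions, and `leaf` when `k` is not 1, are
  -- removed afterwards in `enumerate-step`.
  candidates : List Tree
  candidates = leaf ∷ concat (tabulate {n = k} λ r → map (node (suc (toℕ r))) (tuples smallerTrees (suc (toℕ r)) k))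

  ∈-candidates : ∀ t → leaves t ≡ k → t ∈ₜ candidates
  ∈-candidates t t≡k with leaf-or-node t
  ... | inj₁ t≈leaf        = here t≈leaf
  ... | inj₂ (r , ts , t≈) = there (∈ₛ.∈-resp-≈ treeSetoid (≈ₜ-sym t≈)
    (∈ₛ.∈-concat⁺ treeSetoid (Any.tabulate⁺ (fromℕ< r+2≤k)
      (subst (λ n → node (suc (suc r)) ts ∈ₜ map (node (suc n)) (tuples smallerTrees (suc n) k))
        (≡.sym (Fin.toℕ-fromℕ< r+2≤k))
        (∈ₛ.∈-map⁺ (≋-setoid (suc (suc r))) treeSetoid node-cong
          (subst (λ n → Membership._∈_ (≋-setoid (suc (suc r))) ts (tuples smallerTrees (suc (suc r)) n)) sum≡k
            (∈-tuples⁺ smallerTrees ts λ j → ∈-smallerTrees (subst (leaves (ts j) <_) node≡k (child-leaves< r ts j)))))))))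
    where
    node≡k : leaves (node (suc (suc r)) ts) ≡ k
    node≡k = ≡.trans (≡.sym (leaves-cong t≈)) t≡k
    sum≡k : sum-leaves ts ≡ k
    sum≡k = ≡.trans (≡.sym (leaves-node (suc (suc r)) ts)) node≡k
    r+2≤k : suc r < k
    r+2≤k = subst (suc (suc r) ≤_) node≡k (arity≤leaves (suc (suc r)) ts)

  enumerate-step : Enumeration k
  enumerate-step = record
    { list     = deduplicate _≟ₜ_ (filter size? candidates)
    ; unique   = UniqueDec.deduplicate-! treeDecSetoid (filter size? candidates)
    ; sized    = λ t∈ → proj₂ (∈ₛ.∈-filter⁻ treeSetoid size? size-resp {xs = candidates}
        (∈ₛ.∈-deduplicate⁻ treeSetoid _≟ₜ_ (filter size? candidates) t∈))
    ; complete = λ t t≡k → ∈ₛ.∈-deduplicate⁺ treeSetoid _≟ₜ_ (λ z≈y x≈y → ≈ₜ-trans x≈y (≈ₜ-sym z≈y))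
        (∈ₛ.∈-filter⁺ treeSetoid size? size-resp (∈-candidates t t≡k) t≡k)
    }
    where
    size? : ∀ t → Dec (leaves t ≡ k)
    size? t = leaves t ℕ.≟ k
    size-resp : (λ t → leaves t ≡ k) Respects _≈ₜ_
    size-resp t≈u t≡k = ≡.trans (≡.sym (leaves-cong t≈u)) t≡k

opaque

  enumerate : ∀ k → Enumeration k
  enumerate = <-rec Enumeration (λ k smaller → enumerate-step k smaller)

trees : ℕ → List Tree
trees k = list (enumerate k)

trees-sized : ∀ {k t} → t ∈ₜ trees k → leaves t ≡ k
trees-sized {k} = sized (enumerate k)

-- `node r` is a bijection up to `_≈ₜ_`: injective because a union determines its blocks, and onto
-- the systems divisible by `r` by `∣ₜ⇒node`. As `trees` has no size bound, `r = 1` is included,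
-- where the child is as large as the whole.
count-divisible : ∀ r .{{_ : NonZero r}} k →
                  length (filter (r ∣ₜ?_) (trees k)) ≡ length (tuples trees r k)
count-divisible r k = ≡.trans
  (unique-≃⇒length≡ treeSetoid
    (UniqueProperties.filter⁺ treeSetoid (r ∣ₜ?_) (unique (enumerate k)))
    (UniqueProperties.map⁺ (≋-setoid r) treeSetoid node-injective
      (tuples-unique trees trees-sized (λ i → unique (enumerate i)) r k))
    (λ {t} → forward {t}) (λ {t} → backward {t}))
  (List.length-map (node r) (tuples trees r k))
  where
  forward : ∀ {t} → t ∈ₜ filter (r ∣ₜ?_) (trees k) → t ∈ₜ map (node r) (tuples trees r k)
  forward {t} t∈
    with t∈trees , r∣t ← ∈ₛ.∈-filter⁻ treeSetoid (r ∣ₜ?_) ∣ₜ-resp {xs = trees k} t∈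
    with ts , t≈ ← ∣ₜ⇒node t r r∣t =
    ∈ₛ.∈-resp-≈ treeSetoid (≈ₜ-sym t≈) (∈ₛ.∈-map⁺ (≋-setoid r) treeSetoid node-cong
      (subst (λ n → Membership._∈_ (≋-setoid r) ts (tuples trees r n)) sum≡k
        (∈-tuples⁺ trees ts λ j → complete (enumerate (leaves (ts j))) (ts j) refl)))
    where
    sum≡k : sum-leaves ts ≡ k
    sum≡k = ≡.trans (≡.sym (leaves-node r ts)) (≡.trans (≡.sym (leaves-cong t≈)) (trees-sized t∈trees))
  backward : ∀ {t} → t ∈ₜ map (node r) (tuples trees r k) → t ∈ₜ filter (r ∣ₜ?_) (trees k)
  backward {t} t∈ with ts , ts∈ , t≈ ← ∈ₛ.∈-map⁻ (≋-setoid r) treeSetoid t∈ =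
    ∈ₛ.∈-filter⁺ treeSetoid (r ∣ₜ?_) ∣ₜ-resp
      (complete (enumerate k) t
        (≡.trans (leaves-cong t≈) (≡.trans (leaves-node r ts) (∈-tuples⁻ trees trees-sized ts ts∈))))
      (∣ₜ-resp (≈ₜ-sym t≈) (∣ₜ-node r ts))

-- The gcd of the moduli

commonDivisor : ∀ (cs : List ResidueClass) → ∃[ g ] ∀ r → All (λ c → r ∣ modulus c) cs ⇔ r ∣ g
-- The gcd of no moduli is 0, which every `r` divides.
commonDivisor [] = 0 , λ r → mk⇔ (λ _ → r ℕ.∣0) (λ _ → [])
commonDivisor (c ∷ cs) with g , iff ← commonDivisor cs = gcd (modulus c) g , λ r → mk⇔
  (λ { (r∣c ∷ r∣cs) → gcd-greatest r∣c (to (iff r) r∣cs) })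
  (λ r∣g → ℕ.∣-trans r∣g (gcd[m,n]∣m (modulus c) g) ∷
           from (iff r) (ℕ.∣-trans r∣g (gcd[m,n]∣n (modulus c) g)))

gcdₜ : Tree → ℕ
gcdₜ t = proj₁ (commonDivisor (classes ⟦ t ⟧))

∣ₜ⇔∣gcdₜ : ∀ r t → r ∣ₜ t ⇔ r ∣ gcdₜ t
∣ₜ⇔∣gcdₜ r t = proj₂ (commonDivisor (classes ⟦ t ⟧)) r

-- Some class covers 0, and its modulus is positive. This settles the term `r = 0` and makes the gcd
-- of the moduli positive.
¬0∣ₜ : ∀ t → ¬ 0 ∣ₜ t
¬0∣ₜ t 0∣t with c , c∈ , _ ← find (covers ⟦ t ⟧ (+ 0)) =
  ℕ.≢-nonZero⁻¹ (modulus c) {{modulus-nonZero c}} (ℕ.0∣⇒≡0 (All.lookup 0∣t c∈))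

gcdₜ≢0 : ∀ t → NonZero (gcdₜ t)
gcdₜ≢0 t = ℕ.≢-nonZero λ g≡0 → ¬0∣ₜ t (from (∣ₜ⇔∣gcdₜ 0 t) (subst (0 ∣_) (≡.sym g≡0) (0 ℕ.∣0)))

gcdₜ≤leaves : ∀ t → gcdₜ t ≤ leaves t
gcdₜ≤leaves t = ∣ₜ⇒≤leaves (gcdₜ t) {{gcdₜ≢0 t}} t (from (∣ₜ⇔∣gcdₜ (gcdₜ t) t) ℕ.∣-refl)

gcdₜ≢1 : ∀ t → 1 < leaves t → gcdₜ t ≢ 1
gcdₜ≢1 t 1<t g≡1 with leaf-or-node t
... | inj₁ t≈leaf = contradiction (leaves-cong t≈leaf) (ℕ.>⇒≢ 1<t)
... | inj₂ (r , ts , t≈) with () ← ℕ.∣1⇒≡1 (subst (suc (suc r) ∣_) g≡1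
  (to (∣ₜ⇔∣gcdₜ (suc (suc r)) t) (∣ₜ-resp (≈ₜ-sym t≈) (∣ₜ-node (suc (suc r)) ts))))

leaves≡1⇒leaf : ∀ t → leaves t ≡ 1 → t ≈ₜ leaf
leaves≡1⇒leaf t t≡1 with leaf-or-node t
... | inj₁ t≈leaf = t≈leaf
... | inj₂ (r , ts , t≈) = contradiction
  (ℕ.≤-trans (arity≤leaves (suc (suc r)) ts) (ℕ.≤-reflexive (≡.trans (≡.sym (leaves-cong t≈)) t≡1)))
  λ { (s≤s ()) }

-- The number of natural systems

numNECS : ℕ → ℕ
numNECS k = length (trees k)

trees-0 : trees 0 ≡ []
trees-0 with trees 0 | trees-sized {0}
... | []    | _      = refl
... | t ∷ _ | sized₀ = contradiction (sized₀ (here ≈ₜ-refl)) (ℕ.>⇒≢ (leaves-positive t))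

numNECS-counts : CountsNECS numNECS
numNECS-counts k = record
  { to        = necs
  ; cong      = λ { refl → ≃-refl }
  ; bijective =
      (λ {i} {j} i≈j → unique⇒lookup-injective treeSetoid (unique (enumerate k)) i j (same i≈j))
    , surjective
  }
  where
  necs : Fin (numNECS k) → NECS k
  necs i = record
    { system  = ⟦ lookup (trees k) i ⟧
    ; natural = tree-natural (lookup (trees k) i)
    ; size    = trees-sized (∈ₛ.∈-lookup treeSetoid (trees k) i)
    }
  surjective : ∀ N → ∃[ i ] (∀ {j} → j ≡ i → classes (system (necs j)) ≃ classes (system N))
  surjective N with t , N≃t ← natural⇒tree (natural N) = Any.index t∈ , λ { refl →
    ≃-trans (≃-sym (sameClasses (Any.lookup-index t∈))) (≃-sym N≃t) }
    where
    t∈ : t ∈ₜ trees k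
    t∈ = complete (enumerate k) t (≡.trans (≃⇒∣∣≡ ⟦ t ⟧ (system N) (≃-sym N≃t)) (size N))

-- Sums of the Möbius function over divisors

-- The body of `μ` with the list of primes as a variable. As it is invariant under permutation, μ(p
-- d) can be computed from `p` followed by the primes of `d`.
μ-factors : List ℕ → ℤ
μ-factors ps = if does (unique? ℕ._≟_ ps) then -1ℤ ℤ.^ length ps else 0ℤ

μ-factors-unique : ∀ {ps} → Unique ps → μ-factors ps ≡ -1ℤ ℤ.^ length ps
μ-factors-unique {ps} ps! = cong (if_then -1ℤ ℤ.^ length ps else 0ℤ) (dec-true (unique? ℕ._≟_ ps) ps!)

μ-factors-¬unique : ∀ {ps} → ¬ Unique ps → μ-factors ps ≡ 0ℤ
μ-factors-¬unique {ps} ¬ps! = cong (if_then -1ℤ ℤ.^ length ps else 0ℤ) (dec-false (unique? ℕ._≟_ ps) ¬ps!)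

Unique-resp-↭ : ∀ {xs ys : List ℕ} → xs ↭ ys → Unique xs → Unique ys
Unique-resp-↭ xs↭ys = ↭ₛ.Unique-resp-↭ (≡.setoid ℕ) (↭⇒↭ₛ xs↭ys)

μ-factors-↭ : ∀ {ps qs} → ps ↭ qs → μ-factors ps ≡ μ-factors qs
μ-factors-↭ {ps} {qs} ps↭qs = ≡.cong₂ (λ b n → if b then -1ℤ ℤ.^ n else 0ℤ)
  (does-⇔ (mk⇔ (Unique-resp-↭ ps↭qs) (Unique-resp-↭ (↭-sym ps↭qs))) (unique? ℕ._≟_ ps) (unique? ℕ._≟_ qs))
  (↭.↭-length ps↭qs)

μ-factors-∈ : ∀ {p ps} → p ∈ ps → μ-factors (p ∷ ps) ≡ 0ℤ
μ-factors-∈ {p} {ps} p∈ps = μ-factors-¬unique {p ∷ ps} λ { (p∉ ∷ _) → All.lookup p∉ p∈ps refl }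

μ-factors-∉ : ∀ {p ps} → p ∉ ps → μ-factors (p ∷ ps) ≡ ℤ.- μ-factors ps
μ-factors-∉ {p} {ps} p∉ps = by-cases (unique? ℕ._≟_ ps)
  where
  by-cases : Dec (Unique ps) → μ-factors (p ∷ ps) ≡ ℤ.- μ-factors ps
  by-cases (yes ps!) = ≡.trans (μ-factors-unique {p ∷ ps} (All.¬Any⇒All¬ ps p∉ps ∷ ps!))
    (≡.trans (ℤ.-1*i≡-i _) (cong ℤ.-_ (≡.sym (μ-factors-unique {ps} ps!))))
  by-cases (no ¬ps!) = ≡.trans (μ-factors-¬unique {p ∷ ps} λ { (_ ∷ ps!) → ¬ps! ps! })
    (cong ℤ.-_ (≡.sym (μ-factors-¬unique {ps} ¬ps!)))

module _ {p d} .{{_ : NonZero d}} .{{_ : NonZero (p ℕ.* d)}} (p-prime : Prime p) where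

  private
    ps = factors (factorise d)
    Πps≡d = isFactorisation (factorise d)

    factors-↭ : factors (factorise (p ℕ.* d)) ↭ p ∷ ps
    factors-↭ = factorisationUnique (factorise (p ℕ.* d)) (record
      { factors         = p ∷ ps
      ; isFactorisation = cong (p ℕ.*_) Πps≡d
      ; factorsPrime    = p-prime ∷ factorsPrime (factorise d)
      })

  μ-prime-∣ : p ∣ d → μ (p ℕ.* d) ≡ 0ℤ
  μ-prime-∣ p∣d = ≡.trans (μ-factors-↭ factors-↭) (μ-factors-∈ {p} {ps} (factorisationHasAllPrimeFactors {ps} p-prime
    (subst (p ∣_) Πps≡d p∣d) (factorsPrime (factorise d))))

  μ-prime-∤ : p ∤ d → μ (p ℕ.* d) ≡ ℤ.- μ d
  μ-prime-∤ p∤d = ≡.trans (μ-factors-↭ factors-↭) (μ-factors-∉ {p} {ps} λ p∈ →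
    p∤d (subst (p ∣_) (≡.sym Πps≡d) (∈⇒∣product {ns = ps} p∈)))

∃-prime-divisor : ∀ n .{{_ : NonZero n}} → n ≢ 1 → ∃[ p ] ∃[ m ] Prime p × n ≡ p ℕ.* m
∃-prime-divisor n n≢1 with factorise n
... | record { factors = [] ; isFactorisation = n≡1 } = contradiction n≡1 n≢1
... | record { factors = p ∷ ps ; isFactorisation = n≡ ; factorsPrime = p-prime ∷ _ } =
  p , product ps , p-prime , n≡

prime∤⇒coprime : ∀ {p d} → Prime p → p ∤ d → Coprime d p
prime∤⇒coprime {p} p-prime p∤d {i} (i∣d , i∣p) with prime⇒irreducible p-prime i∣p
... | inj₁ i≡1  = i≡1
... | inj₂ refl = contradiction i∣d p∤d

IsDivisors : List ℕ → ℕ → Set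
IsDivisors ds n = Unique ds × (∀ d → d ∈ ds ⇔ d ∣ n)

divisors : ∀ n .{{_ : NonZero n}} → ∃[ ds ] IsDivisors ds n
divisors n = filter (_∣? n) ks , Unique.filter⁺ (_∣? n) (Unique.tabulate⁺ Fin.toℕ-injective) , λ d → mk⇔
  (λ d∈ → proj₂ (∈-filter⁻ (_∣? n) {xs = ks} d∈))
  (λ d∣n → ∈-filter⁺ (_∣? n) (subst (_∈ ks) (Fin.toℕ-fromℕ< (s≤s (ℕ.∣⇒≤ d∣n)))
    (∈-tabulate⁺ {f = toℕ} (fromℕ< (s≤s (ℕ.∣⇒≤ d∣n))))) d∣n)
  where
  ks : List ℕ
  ks = tabulate {n = suc n} toℕ

length-cartesianProductWith : ∀ {a b c} {A : Set a} {B : Set b} {C : Set c} (f : A → B → C) xs ys →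
                              length (cartesianProductWith f xs ys) ≡ length xs ℕ.* length ys
length-cartesianProductWith f []       ys = refl
length-cartesianProductWith f (x ∷ xs) ys = ≡.trans (List.length-++ (map (f x) ys))
  (≡.cong₂ ℕ._+_ (List.length-map (f x) ys) (length-cartesianProductWith f xs ys))

length-concat-tabulate : ∀ {a} {A : Set a} {n} (f : Fin n → List A) →
                         length (concat (tabulate f)) ≡ sumᵥ (length ∘ f)
length-concat-tabulate {n = zero}  f = refl
length-concat-tabulate {n = suc n} f = ≡.trans (List.length-++ (f Fin.zero))
  (cong (length (f Fin.zero) ℕ.+_) (length-concat-tabulate (f ∘ Fin.suc)))

trees-1 : length (trees 1) ≡ 1
trees-1 = unique-≃⇒length≡ treeSetoid {ys = leaf ∷ []} (Enumeration.unique (enumerate 1)) ([] ∷ [])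
  (λ t∈ → here (leaves≡1⇒leaf _ (trees-sized t∈)))
  (λ { (here t≈leaf) → Enumeration.complete (enumerate 1) _ (leaves-cong t≈leaf) })

module _ {c ℓ} (R : CommutativeRing c ℓ) where

  open CommutativeRing R renaming (refl to ≈-refl)
  open RingProperties ring using (-0#≈0#; -‿involutive; -‿+-comm; +-cancelʳ)
  open SemiringSum semiring
    using (sum; sum-cong-≋; ∑-distrib-+; sum-replicate-zero; sum⁺-syntax)
  open SemiringMult semiring using (×-homo-+; ×1-homo-*) renaming (_×_ to _·_)
  open FormalPowerSeries R
  open import Relation.Binary.Reasoning.Setoid setoid

  ∑⟨_⟩ : ∀ {a} {A : Set a} → List A → (A → Carrier) → Carrier
  ∑⟨ xs ⟩ f = foldr (λ x s → f x + s) 0# xs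

  module _ {a} {A : Set a} where

    Σ-cong : ∀ (xs : List A) {f g} → (∀ {x} → x ∈ xs → f x ≈ g x) → ∑⟨ xs ⟩ f ≈ ∑⟨ xs ⟩ g
    Σ-cong []       f≈g = ≈-refl
    Σ-cong (x ∷ xs) f≈g = +-cong (f≈g (here refl)) (Σ-cong xs (f≈g ∘ there))

    Σ-zero : ∀ (xs : List A) {f} → (∀ {x} → x ∈ xs → f x ≈ 0#) → ∑⟨ xs ⟩ f ≈ 0#
    Σ-zero []       f≈0 = ≈-refl
    Σ-zero (x ∷ xs) f≈0 = trans (+-cong (f≈0 (here refl)) (Σ-zero xs (f≈0 ∘ there))) (+-identityˡ 0#)

    Σ-neg : ∀ (xs : List A) f → ∑⟨ xs ⟩ (λ x → - f x) ≈ - ∑⟨ xs ⟩ f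
    Σ-neg []       f = sym -0#≈0#
    Σ-neg (x ∷ xs) f = trans (+-congˡ (Σ-neg xs f)) (-‿+-comm (f x) (∑⟨ xs ⟩ f))

    +-swap : ∀ x y z → x + (y + z) ≈ y + (x + z)
    +-swap x y z = trans (sym (+-assoc x y z)) (trans (+-congʳ (+-comm x y)) (+-assoc y x z))

    Σ-↭ : ∀ {xs ys : List A} f → xs ↭ ys → ∑⟨ xs ⟩ f ≈ ∑⟨ ys ⟩ f
    Σ-↭ f ↭.refl          = ≈-refl
    Σ-↭ f (↭.prep x p)    = +-congˡ (Σ-↭ f p)
    Σ-↭ f (↭.swap x y p)  = trans (+-congˡ (+-congˡ (Σ-↭ f p))) (+-swap (f x) (f y) _)
    Σ-↭ f (↭.trans p q)   = trans (Σ-↭ f p) (Σ-↭ f q)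

    Σ-partition : ∀ {p} {P : Pred A p} (P? : Decidable P) xs f →
                  ∑⟨ xs ⟩ f ≈ ∑⟨ filter P? xs ⟩ f + ∑⟨ filter (¬? ∘ P?) xs ⟩ f
    Σ-partition P? []       f = sym (+-identityˡ 0#)
    Σ-partition P? (x ∷ xs) f with P? x
    ... | yes _ = trans (+-congˡ (Σ-partition P? xs f)) (sym (+-assoc _ _ _))
    ... | no _  = trans (+-congˡ (Σ-partition P? xs f)) (+-swap _ _ _)

    Σ-set : ∀ {xs ys : List A} f → Unique xs → Unique ys →
            (∀ {x} → x ∈ xs → x ∈ ys) → (∀ {x} → x ∈ ys → x ∈ xs) → ∑⟨ xs ⟩ f ≈ ∑⟨ ys ⟩ f
    Σ-set f xs! ys! xs⊆ys ys⊆xs = Σ-↭ f (∼bag⇒↭ (unique∧set⇒bag xs! ys! (mk⇔ xs⊆ys ys⊆xs)))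

  Σ-map : ∀ {a b} {A : Set a} {B : Set b} (g : A → B) xs f → ∑⟨ map g xs ⟩ f ≈ ∑⟨ xs ⟩ (f ∘ g)
  Σ-map g []       f = ≈-refl
  Σ-map g (x ∷ xs) f = +-congˡ (Σ-map g xs f)

  fromℤ-neg : ∀ i → fromℤ (ℤ.- i) ≈ - fromℤ i
  fromℤ-neg (+ zero)  = sym -0#≈0#
  fromℤ-neg (+ suc n) = ≈-refl
  fromℤ-neg -[1+ n ]  = sym (-‿involutive _)

  M≡fromℤ-μ : ∀ n .{{_ : NonZero n}} → M n ≡ fromℤ (μ n)
  M≡fromℤ-μ (suc n) = refl

  M-prime-∣ : ∀ {p} d .{{_ : NonZero d}} → Prime p → p ∣ d → M (p ℕ.* d) ≈ 0#
  M-prime-∣ {p} d p-prime p∣d = reflexive (≡.trans (M≡fromℤ-μ (p ℕ.* d)) (cong fromℤ (μ-prime-∣ p-prime p∣d)))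
    where instance pd≢0 = ℕ.m*n≢0 p d {{prime⇒nonZero p-prime}}

  M-prime-∤ : ∀ {p} d .{{_ : NonZero d}} → Prime p → p ∤ d → M (p ℕ.* d) ≈ - M d
  M-prime-∤ {p} d p-prime p∤d = begin
    M (p ℕ.* d)        ≡⟨ ≡.trans (M≡fromℤ-μ (p ℕ.* d)) (cong fromℤ (μ-prime-∤ p-prime p∤d)) ⟩
    fromℤ (ℤ.- μ d)    ≈⟨ fromℤ-neg (μ d) ⟩
    - fromℤ (μ d)      ≡⟨ cong -_ (M≡fromℤ-μ d) ⟨
    - M d              ∎
    where instance pd≢0 = ℕ.m*n≢0 p d {{prime⇒nonZero p-prime}}

  -- Write n = p m. The divisors of n prime to p are those of m, and the others are
  -- the p d with d ∣ m, where μ (p d) is − μ d or 0 according to whether p ∤ d.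
  Σ-divisors-M : ∀ {n ds} .{{_ : NonZero n}} → n ≢ 1 → IsDivisors ds n → ∑⟨ ds ⟩ M ≈ 0#
  Σ-divisors-M {n} {ds} n≢1 (ds! , ds∣n) with ∃-prime-divisor n n≢1
  ... | p , m , p-prime , refl = begin
    ∑⟨ ds ⟩ M                                                          ≈⟨ Σ-partition (p ∣?_) ds M ⟩
    ∑⟨ filter (p ∣?_) ds ⟩ M + ∑⟨ filter (¬? ∘ (p ∣?_)) ds ⟩ M         ≈⟨ +-cong multiples nonmultiples ⟩
    ∑⟨ map (p ℕ.*_) es ⟩ M + ∑⟨ es∤ ⟩ M                                ≈⟨ +-congʳ (Σ-map (p ℕ.*_) es M) ⟩
    ∑⟨ es ⟩ (M ∘ (p ℕ.*_)) + ∑⟨ es∤ ⟩ M                                ≈⟨ +-congʳ (Σ-partition (p ∣?_) es _) ⟩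
    ∑⟨ es∣ ⟩ (M ∘ (p ℕ.*_)) + ∑⟨ es∤ ⟩ (M ∘ (p ℕ.*_)) + ∑⟨ es∤ ⟩ M     ≈⟨ +-congʳ (+-cong vanish negate) ⟩
    0# + - ∑⟨ es∤ ⟩ M + ∑⟨ es∤ ⟩ M                                     ≈⟨ +-congʳ (+-identityˡ _) ⟩
    - ∑⟨ es∤ ⟩ M + ∑⟨ es∤ ⟩ M                                          ≈⟨ -‿inverseˡ _ ⟩
    0#                                                                 ∎
    where
    instance
      p≢0 : NonZero p
      p≢0 = prime⇒nonZero p-prime
      m≢0 : NonZero m
      m≢0 = ℕ.m*n≢0⇒n≢0 p
    es : List ℕ
    es = proj₁ (divisors m)
    es! : Unique es
    es! = proj₁ (proj₂ (divisors m))
    es∣m : ∀ d → d ∈ es ⇔ d ∣ m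
    es∣m = proj₂ (proj₂ (divisors m))
    es∣ es∤ : List ℕ
    es∣ = filter (p ∣?_) es
    es∤ = filter (¬? ∘ (p ∣?_)) es
    es-nonZero : ∀ {d} → d ∈ es → NonZero d
    es-nonZero d∈ = ℕ.≢-nonZero λ { refl → ℕ.≢-nonZero⁻¹ m (ℕ.0∣⇒≡0 (to (es∣m 0) d∈)) }
    multiples : ∑⟨ filter (p ∣?_) ds ⟩ M ≈ ∑⟨ map (p ℕ.*_) es ⟩ M
    multiples = Σ-set M (Unique.filter⁺ (p ∣?_) ds!) (Unique.map⁺ (ℕ.*-cancelˡ-≡ _ _ p) es!) fwd bwd
      where
      fwd : ∀ {d} → d ∈ filter (p ∣?_) ds → d ∈ map (p ℕ.*_) es
      fwd d∈ with ∈-filter⁻ (p ∣?_) {xs = ds} d∈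
      ... | d∈ds , ℕ.divides e refl = subst (_∈ map (p ℕ.*_) es) (ℕ.*-comm p e)
        (∈-map⁺ (p ℕ.*_) (from (es∣m e) (ℕ.*-cancelˡ-∣ p
          (subst (_∣ p ℕ.* m) (ℕ.*-comm e p) (to (ds∣n _) d∈ds)))))
      bwd : ∀ {d} → d ∈ map (p ℕ.*_) es → d ∈ filter (p ∣?_) ds
      bwd d∈ with ∈-map⁻ (p ℕ.*_) d∈
      ... | e , e∈ , refl = ∈-filter⁺ (p ∣?_) (from (ds∣n _) (ℕ.*-monoʳ-∣ p (to (es∣m e) e∈))) (ℕ.m∣m*n e)
    nonmultiples : ∑⟨ filter (¬? ∘ (p ∣?_)) ds ⟩ M ≈ ∑⟨ es∤ ⟩ M
    nonmultiples = Σ-set M (Unique.filter⁺ (¬? ∘ (p ∣?_)) ds!) (Unique.filter⁺ (¬? ∘ (p ∣?_)) es!) fwd bwd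
      where
      fwd : ∀ {d} → d ∈ filter (¬? ∘ (p ∣?_)) ds → d ∈ es∤
      fwd {d} d∈ with d∈ds , p∤d ← ∈-filter⁻ (¬? ∘ (p ∣?_)) {xs = ds} d∈ =
        ∈-filter⁺ (¬? ∘ (p ∣?_))
          (from (es∣m d) (coprime-divisor (prime∤⇒coprime p-prime p∤d) (to (ds∣n d) d∈ds))) p∤d
      bwd : ∀ {d} → d ∈ es∤ → d ∈ filter (¬? ∘ (p ∣?_)) ds
      bwd {d} d∈ with d∈es , p∤d ← ∈-filter⁻ (¬? ∘ (p ∣?_)) {xs = es} d∈ =
        ∈-filter⁺ (¬? ∘ (p ∣?_)) (from (ds∣n d) (ℕ.∣n⇒∣m*n p (to (es∣m d) d∈es))) p∤d
    vanish : ∑⟨ es∣ ⟩ (M ∘ (p ℕ.*_)) ≈ 0#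
    vanish = Σ-zero es∣ λ {d} d∈ → let d∈es , p∣d = ∈-filter⁻ (p ∣?_) {xs = es} d∈ in
      M-prime-∣ d {{es-nonZero d∈es}} p-prime p∣d
    negate : ∑⟨ es∤ ⟩ (M ∘ (p ℕ.*_)) ≈ - ∑⟨ es∤ ⟩ M
    negate = trans
      (Σ-cong es∤ λ {d} d∈ → let d∈es , p∤d = ∈-filter⁻ (¬? ∘ (p ∣?_)) {xs = es} d∈ in
        M-prime-∤ d {{es-nonZero d∈es}} p-prime p∤d)
      (Σ-neg es∤ M)

  Σ-divisors-M-1 : ∀ {ds} → IsDivisors ds 1 → ∑⟨ ds ⟩ M ≈ 1#
  Σ-divisors-M-1 {ds} (ds! , ds∣1) = begin
    ∑⟨ ds ⟩ M          ≈⟨ Σ-set M ds! ([] ∷ []) (λ d∈ → here (ℕ.∣1⇒≡1 (to (ds∣1 _) d∈)))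
                            (λ { (here refl) → from (ds∣1 1) ℕ.∣-refl }) ⟩
    (1# + 0#) + 0#     ≈⟨ +-identityʳ _ ⟩
    1# + 0#            ≈⟨ +-identityʳ _ ⟩
    1#                 ∎

  -- The identity M(A(x)) = x

  A : Series
  A = fromPositive (λ k → + numNECS k)

  -- `fromPositive` sets the constant term to 0; this agrees with the count because no system is
  -- empty.
  A≈numNECS : ∀ k → A k ≈ numNECS k · 1#
  A≈numNECS zero    = reflexive (cong (λ L → length L · 1#) (≡.sym trees-0))
  A≈numNECS (suc k) = ≈-refl

  sumᵥ-· : ∀ {n} (f : Fin n → ℕ) → sumᵥ f · 1# ≈ sum (λ i → f i · 1#)
  sumᵥ-· {zero}  f = ≈-refl
  sumᵥ-· {suc n} f = trans (×-homo-+ 1# (f Fin.zero) (sumᵥ (f ∘ Fin.suc))) (+-congˡ (sumᵥ-· (f ∘ Fin.suc)))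

  A^≈tuples : ∀ r k → (A ^ˢ r) k ≈ length (tuples trees r k) · 1#
  A^≈tuples zero    zero    = sym (+-identityʳ 1#)
  A^≈tuples zero    (suc k) = ≈-refl
  A^≈tuples (suc r) k       = begin
    ∑[ i ≤ k ] (A (toℕ i) * (A ^ˢ r) (k ∸ toℕ i))       ≈⟨ sum-cong-≋ entry ⟩
    ∑[ i ≤ k ] (length (tuplesByHead trees r k i) · 1#)  ≈⟨ sumᵥ-· (length ∘ tuplesByHead trees r k) ⟨
    sumᵥ (length ∘ tuplesByHead trees r k) · 1#          ≡⟨ cong (_· 1#)
                                                                (length-concat-tabulate (tuplesByHead trees r k)) ⟨
    length (tuples trees (suc r) k) · 1#                 ∎
    where
    entry : ∀ (i : Fin (suc k)) → A (toℕ i) * (A ^ˢ r) (k ∸ toℕ i) ≈ length (tuplesByHead trees r k i) · 1#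
    entry i = begin
      A (toℕ i) * (A ^ˢ r) (k ∸ toℕ i)
        ≈⟨ *-cong (A≈numNECS (toℕ i)) (A^≈tuples r (k ∸ toℕ i)) ⟩
      numNECS (toℕ i) · 1# * length (tuples trees r (k ∸ toℕ i)) · 1#
        ≈⟨ ×1-homo-* (numNECS (toℕ i)) _ ⟨
      (numNECS (toℕ i) ℕ.* length (tuples trees r (k ∸ toℕ i))) · 1#
        ≡⟨ cong (_· 1#) (length-cartesianProductWith _ (trees (toℕ i)) _) ⟨
      length (tuplesByHead trees r k i) · 1# ∎

  if-divides : ℕ → Tree → Carrier
  if-divides r t = if does (r ∣ₜ? t) then M r else 0#

  Σ-filter : ∀ {a p} {B : Set a} {P : B → Set p} (P? : Decidable P) (f : B → Carrier) xs →
             ∑⟨ filter P? xs ⟩ f ≈ ∑⟨ xs ⟩ (λ x → if does (P? x) then f x else 0#)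
  Σ-filter P? f [] = ≈-refl
  Σ-filter P? f (x ∷ xs) with P? x
  ... | yes _ = +-congˡ (Σ-filter P? f xs)
  ... | no _  = trans (Σ-filter P? f xs) (sym (+-identityˡ _))

  Σ-const : ∀ {a} {B : Set a} x (xs : List B) → ∑⟨ xs ⟩ (λ _ → x) ≈ x * length xs · 1#
  Σ-const x []       = sym (zeroʳ x)
  Σ-const x (_ ∷ xs) = trans (+-cong (sym (*-identityʳ x)) (Σ-const x xs)) (sym (distribˡ x 1# _))

  term : ∀ r k → M r * (A ^ˢ r) k ≈ ∑⟨ trees k ⟩ (if-divides r)
  -- The composition is summed from `r = 0`, where `M 0` is 0 and `¬0∣ₜ` rules out every tree.
  term zero k = trans (zeroˡ _) (sym (Σ-zero (trees k) λ {t} _ →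
    reflexive (cong (if_then 0# else 0#) (dec-false (0 ∣ₜ? t) (¬0∣ₜ t)))))
  term r@(suc _) k = begin
    M r * (A ^ˢ r) k                                 ≈⟨ *-congˡ (A^≈tuples r k) ⟩
    M r * length (tuples trees r k) · 1#             ≡⟨ cong (λ n → M r * n · 1#) (count-divisible r k) ⟨
    M r * length (filter (r ∣ₜ?_) (trees k)) · 1#    ≈⟨ Σ-const (M r) (filter (r ∣ₜ?_) (trees k)) ⟨
    ∑⟨ filter (r ∣ₜ?_) (trees k) ⟩ (λ _ → M r)       ≈⟨ Σ-filter (r ∣ₜ?_) (λ _ → M r) (trees k) ⟩
    ∑⟨ trees k ⟩ (if-divides r)                      ∎

  sum-Σ-swap : ∀ {a} {B : Set a} {n} (f : Fin n → B → Carrier) xs →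
               sum (λ i → ∑⟨ xs ⟩ (f i)) ≈ ∑⟨ xs ⟩ (λ x → sum (λ i → f i x))
  sum-Σ-swap {n = n} f []       = sum-replicate-zero n
  sum-Σ-swap {n = n} f (x ∷ xs) =
    trans (∑-distrib-+ (λ i → f i x) (λ i → ∑⟨ xs ⟩ (f i))) (+-congˡ (sum-Σ-swap f xs))

  sum≈Σ-tabulate : ∀ {a} {B : Set a} {n} (h : Fin n → B) (f : B → Carrier) → sum (f ∘ h) ≈ ∑⟨ tabulate h ⟩ f
  sum≈Σ-tabulate {n = zero}  h f = ≈-refl
  sum≈Σ-tabulate {n = suc n} h f = +-congˡ (sum≈Σ-tabulate (h ∘ Fin.suc) f)

  module _ (k : ℕ) where

    -- The range 0 to `k` is that of the sum over `r` in `M ⟪ A ⟫`. It holds all divisors of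
    -- `gcdₜ t` when `t` has `k` leaves, by `gcdₜ≤leaves`.
    divisorsOf : Tree → List ℕ
    divisorsOf t = filter (_∣ₜ? t) (tabulate {n = suc k} toℕ)

    divisorsOf-correct : ∀ t → leaves t ≡ k → IsDivisors (divisorsOf t) (gcdₜ t)
    divisorsOf-correct t refl = Unique.filter⁺ (_∣ₜ? t) (Unique.tabulate⁺ Fin.toℕ-injective) , λ d → mk⇔
      (λ d∈ → to (∣ₜ⇔∣gcdₜ d t) (proj₂ (∈-filter⁻ (_∣ₜ? t) {xs = tabulate {n = suc k} toℕ} d∈)))
      (λ d∣g → ∈-filter⁺ (_∣ₜ? t) (d∈ d∣g) (from (∣ₜ⇔∣gcdₜ d t) d∣g))
      where
      instance
        g≢0 : NonZero (gcdₜ t)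
        g≢0 = gcdₜ≢0 t
      d∈ : ∀ {d} → d ∣ gcdₜ t → d ∈ tabulate {n = suc k} toℕ
      d∈ d∣g = subst (_∈ tabulate {n = suc k} toℕ) (Fin.toℕ-fromℕ< d<1+k) (∈-tabulate⁺ {f = toℕ} (fromℕ< d<1+k))
        where d<1+k = s≤s (ℕ.≤-trans (ℕ.∣⇒≤ d∣g) (gcdₜ≤leaves t))

    -- Double counting of the pairs of a tree `t` and an `r ≤ k` with `r ∣ₜ t`, each weighted by
    -- μ(r).
    M⟪A⟫≈Σ : (M ⟪ A ⟫) k ≈ ∑⟨ trees k ⟩ (λ t → ∑⟨ divisorsOf t ⟩ M)
    M⟪A⟫≈Σ = begin
      ∑[ r ≤ k ] (M (toℕ r) * (A ^ˢ toℕ r) k)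
        ≈⟨ sum-cong-≋ (λ (r : Fin (suc k)) → term (toℕ r) k) ⟩
      ∑[ r ≤ k ] (∑⟨ trees k ⟩ (if-divides (toℕ r)))
        ≈⟨ sum-Σ-swap (λ (r : Fin (suc k)) → if-divides (toℕ r)) (trees k) ⟩
      ∑⟨ trees k ⟩ (λ t → ∑[ r ≤ k ] if-divides (toℕ r) t)
        ≈⟨ Σ-cong (trees k) (λ {t} _ → trans (sum≈Σ-tabulate {n = suc k} toℕ (λ r → if-divides r t))
             (sym (Σ-filter (_∣ₜ? t) M (tabulate {n = suc k} toℕ)))) ⟩
      ∑⟨ trees k ⟩ (λ t → ∑⟨ divisorsOf t ⟩ M) ∎

  trees-leaves : ∀ {k t} → t ∈ trees k → leaves t ≡ k
  trees-leaves t∈ = trees-sized (Any.map (λ { refl → Setoid.refl treeSetoid }) t∈)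

  M⟪A⟫≋X : M ⟪ A ⟫ ≋ X
  M⟪A⟫≋X zero = trans (M⟪A⟫≈Σ 0) (reflexive (cong (λ L → ∑⟨ L ⟩ (λ t → ∑⟨ divisorsOf 0 t ⟩ M)) trees-0))
  M⟪A⟫≋X (suc zero) = begin
    (M ⟪ A ⟫) 1                                 ≈⟨ M⟪A⟫≈Σ 1 ⟩
    ∑⟨ trees 1 ⟩ (λ t → ∑⟨ divisorsOf 1 t ⟩ M) ≈⟨ Σ-cong (trees 1) (λ {t} t∈ → weight≈1 t (trees-leaves t∈)) ⟩
    ∑⟨ trees 1 ⟩ (λ _ → 1#)                     ≈⟨ Σ-const 1# (trees 1) ⟩
    1# * length (trees 1) · 1#                  ≡⟨ cong (λ n → 1# * n · 1#) trees-1 ⟩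
    1# * (1# + 0#)                              ≈⟨ *-identityˡ _ ⟩
    1# + 0#                                     ≈⟨ +-identityʳ 1# ⟩
    1#                                          ∎
    where
    gcdₜ≡1 : ∀ t → leaves t ≡ 1 → gcdₜ t ≡ 1
    gcdₜ≡1 t t≡1 = ℕ.≤-antisym (subst (gcdₜ t ≤_) t≡1 (gcdₜ≤leaves t)) (ℕ.>-nonZero⁻¹ (gcdₜ t) {{gcdₜ≢0 t}})
    weight≈1 : ∀ t → leaves t ≡ 1 → ∑⟨ divisorsOf 1 t ⟩ M ≈ 1#
    weight≈1 t t≡1 =
      Σ-divisors-M-1 (subst (IsDivisors _) (gcdₜ≡1 t t≡1) (divisorsOf-correct 1 t t≡1))
  M⟪A⟫≋X k@(suc (suc _)) = trans (M⟪A⟫≈Σ k) (Σ-zero (trees k) λ {t} t∈ →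
    Σ-divisors-M {{gcdₜ≢0 t}} (gcdₜ≢1 t (subst (1 <_) (≡.sym (trees-leaves t∈)) (s≤s (s≤s z≤n))))
      (divisorsOf-correct k t (trees-leaves t∈)))

  -- Uniqueness of the solution

  ⊛-identityʳ : ∀ F → F ⊛ 𝟙 ≋ F
  ⊛-identityʳ F zero    = trans (+-identityʳ _) (*-identityʳ (F 0))
  ⊛-identityʳ F (suc n) = trans (+-cong (zeroʳ (F 0)) (⊛-identityʳ (F ∘ suc) n)) (+-identityˡ _)

  ^ˢ-0 : ∀ F → F 0 ≈ 0# → ∀ k → (F ^ˢ suc k) 0 ≈ 0#
  ^ˢ-0 F F0≈0 k = trans (+-identityʳ _) (trans (*-congʳ F0≈0) (zeroˡ _))

  module _ {F G : Series} (F0≈0 : F 0 ≈ 0#) (G0≈0 : G 0 ≈ 0#) {n} (F≈G : ∀ {i} → i < n → F i ≈ G i) where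

    ^ˢ-cong-below : ∀ k {i} → i < n → (F ^ˢ k) i ≈ (G ^ˢ k) i
    ^ˢ-cong-below zero    i<n = ≈-refl
    ^ˢ-cong-below (suc k) {i} i<n = sum-cong-≋ {suc i} λ j → *-cong
      (F≈G (ℕ.≤-<-trans (ℕ.s≤s⁻¹ (Fin.toℕ<n j)) i<n))
      (^ˢ-cong-below k (ℕ.≤-<-trans (ℕ.m∸n≤m i (toℕ j)) i<n))

    -- The coefficients of xⁿ in F and G do not enter, as they are multiplied by constant terms.
    ^ˢ-cong-at : ∀ k → (F ^ˢ suc (suc k)) n ≈ (G ^ˢ suc (suc k)) n
    ^ˢ-cong-at k = sum-cong-≋ {suc n} λ j → entry (toℕ j) (ℕ.s≤s⁻¹ (Fin.toℕ<n j))
      where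
      entry : ∀ j → j ≤ n → F j * (F ^ˢ suc k) (n ∸ j) ≈ G j * (G ^ˢ suc k) (n ∸ j)
      entry zero _ = trans (trans (*-congʳ F0≈0) (zeroˡ _)) (sym (trans (*-congʳ G0≈0) (zeroˡ _)))
      entry j@(suc i) j≤n with j ℕ.≟ n
      ... | yes refl = trans (last F F0≈0) (sym (last G G0≈0))
        where
        last : ∀ H → H 0 ≈ 0# → H j * (H ^ˢ suc k) (j ∸ j) ≈ 0#
        last H H0≈0 = trans (*-congˡ (trans (reflexive (cong (H ^ˢ suc k) (ℕ.n∸n≡0 j))) (^ˢ-0 H H0≈0 k))) (zeroʳ _)
      ... | no j≢n = *-cong (F≈G (ℕ.≤∧≢⇒< j≤n j≢n))
        (^ˢ-cong-below (suc k) (ℕ.∸-monoʳ-< (s≤s z≤n) j≤n))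

  -- The terms of M of degree 0 and 1 are 0 and x, as μ(1) = 1. This isolates `F (suc n)`, and the
  -- rest involves only powers of `F` from the second on.
  M⟪⟫-suc : ∀ F n → (M ⟪ F ⟫) (suc n) ≈
            F (suc n) + sum {n} (λ k → M (suc (suc (toℕ k))) * (F ^ˢ suc (suc (toℕ k))) (suc n))
  M⟪⟫-suc F n = begin
    0# * 𝟙 (suc n) + (M 1 * (F ⊛ 𝟙) (suc n) + rest)   ≈⟨ trans (+-congʳ (zeroˡ _)) (+-identityˡ _) ⟩
    M 1 * (F ⊛ 𝟙) (suc n) + rest                       ≈⟨ +-congʳ (*-cong (+-identityʳ 1#) (⊛-identityʳ F (suc n))) ⟩
    1# * F (suc n) + rest                              ≈⟨ +-congʳ (*-identityˡ _) ⟩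
    F (suc n) + rest                                   ∎
    where rest = sum {n} (λ k → M (suc (suc (toℕ k))) * (F ^ˢ suc (suc (toℕ k))) (suc n))

  -- Strong induction on the degree: by `^ˢ-cong-at` the powers from the second on agree in degree
  -- `suc n` once the coefficients up to `n` do, so these terms cancel and leave
  -- `F (suc n) ≈ G (suc n)`.
  solution-unique : ∀ F G → IsSolution F → IsSolution G → F ≋ G
  solution-unique F G (F0≈0 , MF≋X) (G0≈0 , MG≋X) = <-rec (λ n → F n ≈ G n) step
    where
    step : ∀ n → (∀ {i} → i < n → F i ≈ G i) → F n ≈ G n
    step zero    _   = trans F0≈0 (sym G0≈0)
    step (suc n) F≈G = +-cancelʳ _ (F (suc n)) (G (suc n)) (begin
      F (suc n) + _       ≈⟨ M⟪⟫-suc F n ⟨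
      (M ⟪ F ⟫) (suc n)   ≈⟨ trans (MF≋X (suc n)) (sym (MG≋X (suc n))) ⟩
      (M ⟪ G ⟫) (suc n)   ≈⟨ M⟪⟫-suc G n ⟩
      G (suc n) + _       ≈⟨ +-congˡ (sum-cong-≋ {n} λ k → *-congˡ (^ˢ-cong-at F0≈0 G0≈0 F≈G (toℕ k))) ⟨
      G (suc n) + _       ∎)

theorem1 : (c ℓ : Level) →
    Σ[ a ∈ (ℕ → ℕ) ] CountsNECS a ×
      ((R : CommutativeRing c ℓ) →
        let open FormalPowerSeries R
            A = fromPositive (λ k → + a k)
        in IsSolution A × (∀ B → IsSolution B → B ≋ A))
theorem1 c ℓ = numNECS , numNECS-counts , λ R →
  let open CommutativeRing R using () renaming (refl to ≈-refl)
      isSolution = ≈-refl , M⟪A⟫≋X R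
  in isSolution , λ B B-solution → solution-unique R B (A R) B-solution isSolution
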